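{- The categories $\mathsf{SLata}$ (semilattices with adjunctions and their homomorphisms) and $\mathsf{RelSP}$ (RelS-spaces and adjoint-preserving relations) are dually equivalent.
   Context: **$\mathsf{SLata}$.** A semilattice is a meet-semilattice with greatest element $\mathbf{A}=\langle A,\wedge,1\rangle$, ordered by $a\le b$ iff $a=a\wedge b$; homomorphisms preserve $\wedge$ and $1$. An SLata is $\langle\mathbf{A},i,d\rangle$ with $\mathbf{A}$ a semilattice and $i,d:A\to A$ such that $i(a)\le b\iff a\le d(b)$ for all $a,b\in A$. SLata homomorphisms are semilattice homomorphisms commuting with the operations $i$ and $d$. $\mathsf{SLata}$ is the category of SLatas and SLata homomorphisms. **S-spaces.** Let $X$ be a set and $\mathcal{K}\subseteq\mathcal{P}(X)$, regarded as a subbase of a topology on $X$. Put $S(X)=\{U^c: U\in\mathcal{K}\}$ and $\mathcal{C}_{\mathcal{K}}(X)=\{\bigcap\mathcal{A}:\mathcal{A}\subseteq S(X)\}$. For $Y\subseteq X$, a family $\mathcal{J}\subseteq S(X)$ is a $Y$-family if for all $A,B\in\mathcal{J}$ there are $H\in S(X)$, $C\in\mathcal{J}$ with $Y\subseteq H$, $A\cap H\subseteq C$ and $B\cap H\subseteq C$. $\langle X,\mathcal{K}\rangle$ is an S-space if: (S1) the topology is $T_0$ and $X=\bigcup\mathcal{K}$; (S2) $\mathcal{K}$ is a subbase of compact open sets, closed under finite unions, and $\emptyset\in\mathcal{K}$; (S3) if $x\in U\cap V$ with $U,V\in\mathcal{K}$, there are $W,D\in\mathcal{K}$ with $x\notin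 W$, $x\in D$, $D\subseteq(U\cap V)\cup W$; (S4) if $Y\in\mathcal{C}_{\mathcal{K}}(X)$ and $\mathcal{J}\subseteq S(X)$ is a $Y$-family with $Y\cap A^c\neq\emptyset$ for all $A\in\mathcal{J}$, then $Y\cap\bigcap\{A^c:A\in\mathcal{J}\}\neq\emptyset$. Put $\mathrm{cl}_{\mathcal{K}}(x)=\bigcap\{U\in S(X):x\in U\}$. The dual specialization order is: $x\sqsupseteq_X y$ iff $y\in\mathrm{cl}_{\mathcal{K}}(x)$; relative to it, $\uparrow x=\mathrm{cl}_{\mathcal{K}}(x)$. **Meet-relations.** For $T\subseteq X\times Y$ write $T(x)=\{y:(x,y)\in T\}$ and $\Box_T(U)=\{x\in X:T(x)\subseteq U\}$. A meet-relation between S-spaces $\langle X_1,\mathcal{K}_1\rangle$ and $\langle X_2,\mathcal{K}_2\rangle$ is $T\subseteq X_1\times X_2$ such that $\Box_T(U)\in S(X_1)$ for all $U\in S(X_2)$, and $T(x)=\bigcap\{U\in S(X_2):T(x)\subseteq U\}$ for all $x\in X_1$. For relations $R\subseteq X_1\times X_2$, $T\subseteq X_2\times X_3$ between S-spaces, put $T*R=\{(x,z)\in X_1\times X_3:\forall U\in S(X_3)\,((T\circ R)(x)\subseteq U\Rightarrow z\in U)\}$, where $(T\circ R)(x)=\bigcup_{y\in R(x)}T(y)$. **$\mathsf{RelSP}$.** For an S-space and $U\in S(X)$ let $D_U=\{Y\in\mathcal{C}_{\mathcal{K}}(X):Y\subseteq U\}$. A relation $T\subseteq X\times X$ on an S-space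 $\langle X,\mathcal{K}\rangle$ is an A-relation if: (1) $\Box_T(U)\in S(X)$ for every $U\in S(X)$; (2) for all $U\in S(X)$, $\bigcap F_U^T\in S(X)$, where $F_U^T=\{V\in S(X):U\subseteq\Box_T(V)\}$. A RelS-space is $\langle X,\mathcal{K},T\rangle$ where $\langle X,\mathcal{K}\rangle$ is an S-space and $T\subseteq X\times X$ is an A-relation. Given RelS-spaces $\langle X,\mathcal{K}_X,T_X\rangle$, $\langle Y,\mathcal{K}_Y,T_Y\rangle$, a relation $M\subseteq X\times Y$ is adjoint-preserving if: (1) $M$ is a meet-relation; (2) $M*T_X=T_Y*M$; (3) for every $x\in X$, $U\in S(X)$ and $V\in S(Y)$: $(M(x)\in D_V\Rightarrow T_X(x)\in D_U)\Rightarrow(M(x)\in\bigcap_{W\in F_V^{T_Y}}D_W\Rightarrow\ \uparrow x\in D_U)$. $\mathsf{RelSP}$ has RelS-spaces as objects, adjoint-preserving relations as morphisms, composition $*$, and identities $\sqsupseteq_X$.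
   Formalization: Y-families are taken non-empty (else no S-space exists); in condition (3) of adjoint-preserving, x is quantified separately in premise and conclusion (else identities fail), and T_X(x) is replaced by its closure ⋂{W∈S(X): T_X(x)⊆W} (else composites fail). -}

module Defs where

open import Algebra.Core using (Op₁)
open import Algebra.Lattice.Bundles using (BoundedMeetSemilattice)
import Algebra.Morphism.Definitions as Homomorphic
open import Data.Empty.Polymorphic using (⊥)
open import Data.List.Base using (List)
open import Data.List.Relation.Unary.All using (All)
open import Data.List.Relation.Unary.Any using (Any)
open import Data.Product.Base using (Σ-syntax; ∃-syntax; _×_; _,_; proj₁; proj₂)
open import Data.Sum.Base using (_⊎_)
open import Function.Definitions using (Congruent)
open import Level using (Level; suc; _⊔_)
open import Relation.Binary.Bundles using (Poset; Setoid)
import Relation.Binary.Construct.NaturalOrder.Left as NaturalOrder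
open import Relation.Binary.Core using (Rel; REL; _⇔_)
open import Relation.Binary.Definitions using (Adjoint; _Respects_; _Respects₂_)
open import Relation.Binary.Structures using (IsEquivalence)
open import Relation.Unary using (Pred; _∈_; _∉_; _⊆_; _≐_; ∁; _∩_; _∪_; Satisfiable)

private
  variable
    a b c ℓ m o e o′ m′ e′ o″ m″ e″ r : Level

ZornsLemma : ∀ c ℓ₁ ℓ₂ ℓ₃ → Set (suc (c ⊔ ℓ₁ ⊔ ℓ₂ ⊔ ℓ₃))
ZornsLemma c ℓ₁ ℓ₂ ℓ₃ =
  (P : Poset c ℓ₁ ℓ₂) → let open Poset P in
  ((C : Pred Carrier ℓ₃) →
     (∀ {x y} → x ∈ C → y ∈ C → x ≤ y ⊎ y ≤ x) →
     ∃[ u ] (∀ {x} → x ∈ C → x ≤ u)) →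
  ∃[ m ] (∀ {x} → m ≤ x → x ≈ m)

record Category o m e : Set (suc (o ⊔ m ⊔ e)) where
  infix  4 _≈_
  infixr 9 _∘_
  field
    Obj       : Set o
    Hom       : Obj → Obj → Set m
    _≈_       : ∀ {A B} → Rel (Hom A B) e
    id        : ∀ {A} → Hom A A
    _∘_       : ∀ {A B C} → Hom B C → Hom A B → Hom A C
    equiv     : ∀ {A B} → IsEquivalence (_≈_ {A} {B})
    ∘-resp-≈  : ∀ {A B C} {f f′ : Hom B C} {g g′ : Hom A B} →
                f ≈ f′ → g ≈ g′ → f ∘ g ≈ f′ ∘ g′
    assoc     : ∀ {A B C D} (f : Hom C D) (g : Hom B C) (h : Hom A B) →
                (f ∘ g) ∘ h ≈ f ∘ (g ∘ h)
    identityˡ : ∀ {A B} (f : Hom A B) → id ∘ f ≈ f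
    identityʳ : ∀ {A B} (f : Hom A B) → f ∘ id ≈ f

op : Category o m e → Category o m e
op C = record
  { Obj       = Obj
  ; Hom       = λ A B → Hom B A
  ; _≈_       = _≈_
  ; id        = id
  ; _∘_       = λ f g → g ∘ f
  ; equiv     = equiv
  ; ∘-resp-≈  = λ f≈f′ g≈g′ → ∘-resp-≈ g≈g′ f≈f′
  ; assoc     = λ f g h → IsEquivalence.sym equiv (assoc h g f)
  ; identityˡ = identityʳ
  ; identityʳ = identityˡ
  } where open Category C

record Functor (C : Category o m e) (D : Category o′ m′ e′) :
               Set (o ⊔ m ⊔ e ⊔ o′ ⊔ m′ ⊔ e′) where
  private
    module C = Category C
    module D = Category D
  field
    F₀           : C.Obj → D.Obj
    F₁           : ∀ {A B} → C.Hom A B → D.Hom (F₀ A) (F₀ B)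
    F-resp-≈     : ∀ {A B} {f g : C.Hom A B} → f C.≈ g → F₁ f D.≈ F₁ g
    identity     : ∀ {A} → F₁ (C.id {A}) D.≈ D.id
    homomorphism : ∀ {A B E} (g : C.Hom B E) (f : C.Hom A B) →
                   F₁ (g C.∘ f) D.≈ F₁ g D.∘ F₁ f

idF : {C : Category o m e} → Functor C C
idF {C = C} = record
  { F₀           = λ A → A
  ; F₁           = λ f → f
  ; F-resp-≈     = λ f≈g → f≈g
  ; identity     = IsEquivalence.refl equiv
  ; homomorphism = λ g f → IsEquivalence.refl equiv
  } where open Category C

infixr 9 _∘F_
_∘F_ : {C : Category o m e} {D : Category o′ m′ e′} {E : Category o″ m″ e″} →
       Functor D E → Functor C D → Functor C E
_∘F_ {E = E} G F = record
  { F₀           = λ A → G.F₀ (F.F₀ A)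
  ; F₁           = λ f → G.F₁ (F.F₁ f)
  ; F-resp-≈     = λ f≈g → G.F-resp-≈ (F.F-resp-≈ f≈g)
  ; identity     = trans (G.F-resp-≈ F.identity) G.identity
  ; homomorphism = λ g f → trans (G.F-resp-≈ (F.homomorphism g f))
                                 (G.homomorphism (F.F₁ g) (F.F₁ f))
  } where
  module F = Functor F
  module G = Functor G
  trans : ∀ {A B} {f g h : Category.Hom E A B} → _
  trans {f = f} {g} {h} = IsEquivalence.trans (Category.equiv E) {f} {g} {h}

record NaturalIsomorphism {C : Category o m e} {D : Category o′ m′ e′}
                          (F G : Functor C D) :
                          Set (o ⊔ m ⊔ m′ ⊔ e′) where
  private
    module C = Category C
    module F = Functor F
    module G = Functor G
  open Category D
  field
    η       : ∀ A → Hom (F.F₀ A) (G.F₀ A)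
    η⁻¹     : ∀ A → Hom (G.F₀ A) (F.F₀ A)
    natural : ∀ {A B} (f : C.Hom A B) → η B ∘ F.F₁ f ≈ G.F₁ f ∘ η A
    isoˡ    : ∀ A → η⁻¹ A ∘ η A ≈ id
    isoʳ    : ∀ A → η A ∘ η⁻¹ A ≈ id

record Equivalence (C : Category o m e) (D : Category o′ m′ e′) :
                   Set (o ⊔ m ⊔ e ⊔ o′ ⊔ m′ ⊔ e′) where
  field
    F    : Functor C D
    G    : Functor D C
    unit : NaturalIsomorphism idF (G ∘F F)
    counit : NaturalIsomorphism (F ∘F G) idF

DuallyEquivalent : Category o m e → Category o′ m′ e′ →
                   Set (o ⊔ m ⊔ e ⊔ o′ ⊔ m′ ⊔ e′)
DuallyEquivalent C D = Equivalence (op C) D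

record SLataObj ℓ : Set (suc ℓ) where
  field
    boundedMeetSemilattice : BoundedMeetSemilattice ℓ ℓ

  open BoundedMeetSemilattice boundedMeetSemilattice public

  open NaturalOrder _≈_ _∧_ public using (_≤_)

  field
    i       : Op₁ Carrier
    d       : Op₁ Carrier
    i-cong  : Congruent _≈_ _≈_ i
    d-cong  : Congruent _≈_ _≈_ d
    adjoint : Adjoint _≤_ _≤_ i d

record SLataHom (A B : SLataObj ℓ) : Set ℓ where
  private
    module A = SLataObj A
    module B = SLataObj B
  open Homomorphic A.Carrier B.Carrier B._≈_
  field
    ⟦_⟧    : A.Carrier → B.Carrier
    cong   : Congruent A._≈_ B._≈_ ⟦_⟧
    ∧-homo : Homomorphic₂ ⟦_⟧ A._∧_ B._∧_
    ⊤-homo : Homomorphic₀ ⟦_⟧ A.⊤ B.⊤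
    i-homo : Homomorphic₁ ⟦_⟧ A.i B.i
    d-homo : Homomorphic₁ ⟦_⟧ A.d B.d

SLata : ∀ ℓ → Category (suc ℓ) ℓ ℓ
SLata ℓ = record
  { Obj       = SLataObj ℓ
  ; Hom       = SLataHom
  ; _≈_       = λ {A} {B} f g → ∀ x → SLataObj._≈_ B (⟦ f ⟧ x) (⟦ g ⟧ x)
  ; id        = λ {A} → let module A = SLataObj A in record
    { ⟦_⟧    = λ x → x
    ; cong   = λ p → p
    ; ∧-homo = λ _ _ → A.refl
    ; ⊤-homo = A.refl
    ; i-homo = λ _ → A.refl
    ; d-homo = λ _ → A.refl
    }
  ; _∘_       = λ {_} {_} {C} g f →
    let module C = SLataObj C
        module f = SLataHom f
        module g = SLataHom g
    in record
    { ⟦_⟧    = λ x → ⟦ g ⟧ (⟦ f ⟧ x)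
    ; cong   = λ p → g.cong (f.cong p)
    ; ∧-homo = λ x y → C.trans (g.cong (f.∧-homo x y)) (g.∧-homo _ _)
    ; ⊤-homo = C.trans (g.cong f.⊤-homo) g.⊤-homo
    ; i-homo = λ x → C.trans (g.cong (f.i-homo x)) (g.i-homo _)
    ; d-homo = λ x → C.trans (g.cong (f.d-homo x)) (g.d-homo _)
    }
  ; equiv     = λ {_} {B} → let module B = SLataObj B in record
    { refl  = λ _ → B.refl
    ; sym   = λ p x → B.sym (p x)
    ; trans = λ p q x → B.trans (p x) (q x)
    }
  ; ∘-resp-≈  = λ {_} {_} {C} {f} {_} {_} {g′} p q x →
                  SLataObj.trans C (SLataHom.cong f (q x)) (p (⟦ g′ ⟧ x))
  ; assoc     = λ {_} {_} {_} {D} _ _ _ _ → SLataObj.refl D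
  ; identityˡ = λ {_} {B} _ _ → SLataObj.refl B
  ; identityʳ = λ {_} {B} _ _ → SLataObj.refl B
  } where open SLataHom using (⟦_⟧)

-- Subsets are predicates.  Intersections of arbitrary families of small
-- subsets, and everything defined by quantifying over small subsets, such as
-- composites of relations, live one universe level up.

Family : Set ℓ → Set (suc (suc ℓ))
Family {ℓ} X = Pred (Pred X ℓ) (suc ℓ)

module _ {X : Set ℓ} where

  ⋂ ⋃ : Family X → Pred X (suc ℓ)
  ⋂ 𝒜 x = (U : Pred X ℓ) → U ∈ 𝒜 → x ∈ U
  ⋃ 𝒜 x = Σ[ U ∈ Pred X ℓ ] (U ∈ 𝒜 × x ∈ U)

  -- { U ᶜ ∣ U ∈ 𝒜 }; a subset of any level may belong to it.
  complements : Family X → Pred (Pred X m) (m ⊔ suc ℓ)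
  complements 𝒜 V = Σ[ U ∈ Pred X ℓ ] (U ∈ 𝒜 × V ≐ ∁ U)

module Subbase {X : Set ℓ} (𝒦 : Family X) where

  -- The topology with subbase 𝒦: unions of finite intersections of members.
  Open : Pred X ℓ → Set (suc ℓ)
  Open O = ∀ {x} → x ∈ O →
           Σ[ Us ∈ List (Pred X ℓ) ]
             (All (_∈ 𝒦) Us × All (x ∈_) Us × (∀ {y} → All (y ∈_) Us → y ∈ O))

  Compact : Pred X ℓ → Set (suc (suc ℓ))
  Compact U = (𝒪 : Family X) → (∀ {O} → O ∈ 𝒪 → Open O) → U ⊆ ⋃ 𝒪 →
              Σ[ Os ∈ List (Pred X ℓ) ]
                (All (_∈ 𝒪) Os × (∀ {x} → x ∈ U → Any (x ∈_) Os))

  S : Pred (Pred X m) (m ⊔ suc ℓ)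
  S = complements 𝒦

  C : Pred (Pred X (suc ℓ)) (suc (suc ℓ))
  C Y = Σ[ 𝒜 ∈ Family X ] (𝒜 ⊆ S × Y ≐ ⋂ 𝒜)

  -- 𝒥 is a Y-family.  Families are non-empty here: ⋂ S = ∅ in a space covered
  -- by 𝒦, so S4 for Y = ⋂ S and 𝒥 = ∅ would fail in every such space.
  record IsFamilyFor (Y : Pred X (suc ℓ)) (𝒥 : Family X) : Set (suc ℓ) where
    field
      nonempty : Satisfiable 𝒥
      directed : ∀ {A B} → A ∈ 𝒥 → B ∈ 𝒥 →
                 Σ[ H ∈ Pred X ℓ ] Σ[ E ∈ Pred X ℓ ]
                   (H ∈ S × E ∈ 𝒥 × Y ⊆ H × A ∩ H ⊆ E × B ∩ H ⊆ E)

  cl : X → Pred X (suc ℓ)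
  cl x = ⋂ (λ U → U ∈ S × x ∈ U)

  -- The least member of C that includes Z.
  hull : Pred X (suc ℓ) → Pred X (suc ℓ)
  hull Z = ⋂ (λ U → U ∈ S × Z ⊆ U)

  D : Pred X ℓ → Pred (Pred X (suc ℓ)) (suc (suc ℓ))
  D U Y = Y ∈ C × Y ⊆ U

record SSpace ℓ : Set (suc (suc ℓ)) where
  field
    points : Setoid ℓ ℓ

  open Setoid points public using (_≈_) renaming (Carrier to Point)

  field
    𝒦 : Family Point

  open Subbase 𝒦 public

  field
    -- 𝒦 is a set of subsets of the setoid of points.
    𝒦-resp-≐       : 𝒦 Respects _≐_
    member-resp-≈  : ∀ {U} → U ∈ 𝒦 → U Respects _≈_

    T₀             : ∀ {x y} →
                     (∀ {O} → Open O → (x ∈ O → y ∈ O) × (y ∈ O → x ∈ O)) →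
                     x ≈ y
    covers         : ∀ x → x ∈ ⋃ 𝒦

    compact        : ∀ {U} → U ∈ 𝒦 → Compact U
    ∪-closed       : ∀ {U V} → U ∈ 𝒦 → V ∈ 𝒦 → (U ∪ V) ∈ 𝒦
    ∅-closed       : (λ _ → ⊥) ∈ 𝒦

    S3             : ∀ {x U V} → U ∈ 𝒦 → V ∈ 𝒦 → x ∈ U ∩ V →
                     Σ[ W ∈ Pred Point ℓ ] Σ[ E ∈ Pred Point ℓ ]
                       (W ∈ 𝒦 × E ∈ 𝒦 × x ∉ W × x ∈ E × E ⊆ (U ∩ V) ∪ W)

    S4             : ∀ {Y} {𝒥 : Family Point} → Y ∈ C → 𝒥 ⊆ S →
                     IsFamilyFor Y 𝒥 →
                     (∀ {A} → A ∈ 𝒥 → Satisfiable (Y ∩ ∁ A)) →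
                     Satisfiable (Y ∩ ⋂ (complements 𝒥))

Relation : SSpace ℓ → SSpace ℓ → Set (suc (suc ℓ))
Relation {ℓ} X Y = REL (SSpace.Point X) (SSpace.Point Y) (suc ℓ)

□ : {A : Set a} {B : Set b} → REL A B r → Pred B m → Pred A (b ⊔ r ⊔ m)
□ T U x = T x ⊆ U

-- No separate condition on the equality of points is needed: both fields
-- force M to respect it.
record IsMeetRelation (X Y : SSpace ℓ) (M : Relation X Y) :
                      Set (suc (suc ℓ)) where
  private
    module X = SSpace X
    module Y = SSpace Y
  field
    □-closed : {U : Pred Y.Point ℓ} → U ∈ Y.S → □ M U ∈ X.S
    closed   : ∀ x → M x ≐ Y.hull (M x)

-- The composite T * R; the hull unfolds to its defining condition.
compose : (X Y Z : SSpace ℓ) → Relation Y Z → Relation X Y → Relation X Z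
compose X Y Z T R x = SSpace.hull Z (λ z → ∃[ y ] (R x y × T y z))

-- y ∈ specialization X x means x ⊒ y.
specialization : (X : SSpace ℓ) → Relation X X
specialization X = SSpace.cl X

module _ (X : SSpace ℓ) where
  open SSpace X

  F : Relation X X → Pred Point m → Pred (Pred Point ℓ) (m ⊔ suc ℓ)
  F T U V = V ∈ S × U ⊆ □ T V

  record IsARelation (T : Relation X X) : Set (suc (suc ℓ)) where
    field
      resp-≈    : T Respects₂ _≈_
      □-closed  : {U : Pred Point ℓ} → U ∈ S → □ T U ∈ S
      ⋂F-closed : {U : Pred Point ℓ} → U ∈ S → ⋂ (F T U) ∈ S

record RelSSpace ℓ : Set (suc (suc ℓ)) where
  field
    space       : SSpace ℓ
    T           : Relation space space
    isARelation : IsARelation space T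

  open SSpace space public
  open IsARelation isARelation public

record IsAdjointPreserving (X Y : RelSSpace ℓ)
                           (M : Relation (RelSSpace.space X) (RelSSpace.space Y)) :
                           Set (suc (suc ℓ)) where
  private
    module X = RelSSpace X
    module Y = RelSSpace Y
  field
    isMeetRelation : IsMeetRelation X.space Y.space M

    commutes       : compose X.space X.space Y.space M X.T ⇔
                     compose X.space Y.space Y.space Y.T M

    -- The two implications are each universally quantified over points: the
    -- condition says that □ M V ⊆ □ T U entails □ M (⋂ (F T V)) ⊆ U.  With
    -- one x shared by hypothesis and conclusion, identities would not satisfy
    -- it.  An A-relation need not have point images in C, whereas D U
    -- consists of elements of C; so T x enters through its hull, which lies
    -- in a U ∈ S exactly when T x does.
    adjoint        : {U : Pred X.Point ℓ} {V : Pred Y.Point ℓ} →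
                     U ∈ X.S → V ∈ Y.S →
                     (∀ x → M x ∈ Y.D V → X.hull (X.T x) ∈ X.D U) →
                     (∀ x → (∀ {W} → W ∈ F Y.space Y.T V → M x ∈ Y.D W) →
                            X.cl x ∈ X.D U)

  open IsMeetRelation isMeetRelation public

record AdjointPreserving (X Y : RelSSpace ℓ) : Set (suc (suc ℓ)) where
  field
    rel                 : Relation (RelSSpace.space X) (RelSSpace.space Y)
    isAdjointPreserving : IsAdjointPreserving X Y rel

  open IsAdjointPreserving isAdjointPreserving public

module _ (X : SSpace ℓ) where
  open SSpace X

  ∁∈S : {U : Pred Point ℓ} → U ∈ 𝒦 → ∁ U ∈ S
  ∁∈S U∈𝒦 = _ , U∈𝒦 , (λ q → q) , (λ q → q)

  hull-⊇ : (Z : Pred Point (suc ℓ)) → Z ⊆ hull Z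
  hull-⊇ Z z∈Z U (_ , Z⊆U) = Z⊆U z∈Z

  hull-least : {Z : Pred Point (suc ℓ)} {V : Pred Point m} → V ∈ S → Z ⊆ V → hull Z ⊆ V
  hull-least (U , U∈𝒦 , V⊆ , V⊇) Z⊆V p = V⊇ (p (∁ U) (∁∈S U∈𝒦 , λ z → V⊆ (Z⊆V z)))

  hull∈C : (Z : Pred Point (suc ℓ)) → hull Z ∈ C
  hull∈C Z = _ , proj₁ , (λ p → p) , (λ p → p)

  cl∈C : (x : Point) → cl x ∈ C
  cl∈C x = _ , proj₁ , (λ p → p) , (λ p → p)

  self∈cl : (x : Point) → x ∈ cl x
  self∈cl x U (_ , x∈U) = x∈U

  cl⊆ : ∀ {x} {V : Pred Point m} → V ∈ S → x ∈ V → cl x ⊆ V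
  cl⊆ (U , U∈𝒦 , V⊆ , V⊇) x∈V p = V⊇ (p (∁ U) (∁∈S U∈𝒦 , V⊆ x∈V))

  S-resp-≐ : {V : Pred Point m} {W : Pred Point r} → V ≐ W → V ∈ S → W ∈ S
  S-resp-≐ (V⊆ , V⊇) (U , U∈𝒦 , p , q) =
    U , U∈𝒦 , (λ w → p (V⊇ w)) , (λ u → V⊆ (q u))

  □-cl : {V : Pred Point m} → V ∈ S → □ (specialization X) V ≐ V
  □-cl V∈S = (λ p → p (self∈cl _)) , cl⊆ V∈S

module _ (X Y Z : SSpace ℓ) {T : Relation Y Z} {R : Relation X Y} where
  private
    module Z = SSpace Z

  □-compose : {U : Pred Z.Point m} → U ∈ Z.S → □ (compose X Y Z T R) U ≐ □ R (□ T U)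
  □-compose U∈S =
      (λ p r t → p (hull-⊇ Z _ (_ , r , t)))
    , (λ p → hull-least Z U∈S (λ (_ , r , t) → p r t))

  -- Composites are determined by their action on S; it suffices to compare boxes.
  compose-⇔ : (W : SSpace ℓ) {T′ : Relation W Z} {R′ : Relation X W} →
              ({U : Pred Z.Point ℓ} → U ∈ Z.S → □ R (□ T U) ≐ □ R′ (□ T′ U)) →
              compose X Y Z T R ⇔ compose X W Z T′ R′
  compose-⇔ W h =
      (λ p U (U∈S , q) → p U (U∈S , λ (_ , r , t) → proj₂ (h U∈S) (λ r′ t′ → q (_ , r′ , t′)) r t))
    , (λ p U (U∈S , q) → p U (U∈S , λ (_ , r , t) → proj₁ (h U∈S) (λ r′ t′ → q (_ , r′ , t′)) r t))

  compose-closed : {M : Relation X Z} → (∀ x → M x ≐ Z.hull (M x)) →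
                   ({U : Pred Z.Point ℓ} → U ∈ Z.S → □ R (□ T U) ≐ □ M U) →
                   compose X Y Z T R ⇔ M
  compose-closed closed h =
      (λ {x} p → proj₂ (closed x) (λ U (U∈S , q) →
         p U (U∈S , λ (_ , r , t) → proj₂ (h U∈S) q r t)))
    , (λ p U (U∈S , q) → proj₁ (h U∈S) (λ r t → q (_ , r , t)) p)

□-resp-≐ : {A : Set a} {B : Set b} {T : REL A B r} {U : Pred B m} {V : Pred B o} →
           U ≐ V → □ T U ≐ □ T V
□-resp-≐ (p , q) = (λ h t → p (h t)) , (λ h t → q (h t))

□-resp-⇔ : {A : Set a} {B : Set b} {T : REL A B r} {T′ : REL A B c} {U : Pred B m} →
           T ⇔ T′ → □ T U ≐ □ T′ U
□-resp-⇔ (p , q) = (λ h t → h (q t)) , (λ h t → h (p t))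

≐-trans : {A : Set a} {P : Pred A m} {Q : Pred A o} {R : Pred A r} → P ≐ Q → Q ≐ R → P ≐ R
≐-trans (p , p′) (q , q′) = (λ x → q (p x)) , (λ x → p′ (q′ x))

≐-sym : {A : Set a} {P : Pred A m} {Q : Pred A o} → P ≐ Q → Q ≐ P
≐-sym (p , q) = q , p

module _ {X Y : SSpace ℓ} {M : Relation X Y} (M-meet : IsMeetRelation X Y M) where
  private
    module X = SSpace X
    module Y = SSpace Y
  open IsMeetRelation M-meet

  □∈S : {U : Pred Y.Point m} → U ∈ Y.S → □ M U ∈ X.S
  □∈S (U , U∈𝒦 , p) = S-resp-≐ X (□-resp-≐ (≐-sym p)) (□-closed (∁∈S Y U∈𝒦))

  image∈C : ∀ x → M x ∈ Y.C
  image∈C x = _ , proj₁ , closed x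

commutes⇒□ : (X Y : RelSSpace ℓ) {M : Relation (RelSSpace.space X) (RelSSpace.space Y)} →
             IsAdjointPreserving X Y M →
             {U : Pred (RelSSpace.Point Y) m} → U ∈ RelSSpace.S Y →
             □ (RelSSpace.T X) (□ M U) ≐ □ M (□ (RelSSpace.T Y) U)
commutes⇒□ X Y M-adj U∈S =
  ≐-trans (≐-sym (□-compose X.space X.space Y.space U∈S))
    (≐-trans (□-resp-⇔ commutes) (□-compose X.space Y.space Y.space U∈S))
  where
  module X = RelSSpace X
  module Y = RelSSpace Y
  open IsAdjointPreserving M-adj

idAdjointPreserving : (X : RelSSpace ℓ) → AdjointPreserving X X
idAdjointPreserving X = record
  { rel = specialization space
  ; isAdjointPreserving = record
    { isMeetRelation = record
      { □-closed = λ U∈S → S-resp-≐ space (≐-sym (□-cl space U∈S)) U∈S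
      ; closed   = λ x → hull-⊇ space _ ,
                         (λ p U (U∈S , x∈U) → p U (U∈S , cl⊆ space U∈S x∈U))
      }
    ; commutes = compose-⇔ space space space space
        (λ U∈S → ≐-trans (□-resp-≐ (□-cl space U∈S))
                         (≐-sym (□-cl space (□-closed U∈S))))
    ; adjoint  = λ U∈S V∈S h x k → k (U∈S , λ {y} y∈V t →
        proj₂ (h y (cl∈C space y , cl⊆ space V∈S y∈V)) (hull-⊇ space _ t))
    }
  } where open RelSSpace X

composeAdjointPreserving : {X Y Z : RelSSpace ℓ} →
  AdjointPreserving Y Z → AdjointPreserving X Y → AdjointPreserving X Z
composeAdjointPreserving {X = X} {Y} {Z} N M = record
  { rel = NM
  ; isAdjointPreserving = record
    { isMeetRelation = record
      { □-closed = λ U∈S → S-resp-≐ X.space (≐-sym (□NM U∈S))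
                             (□∈S M.isMeetRelation (□∈S N.isMeetRelation U∈S))
      ; closed   = λ x → hull-⊇ Z.space _ , (λ p U (U∈S , q) →
                           p U (U∈S , hull-least Z.space U∈S q))
      }
    ; commutes = compose-⇔ X.space X.space Z.space Z.space (λ U∈S →
        ≐-trans (□-resp-≐ (□NM U∈S))
        (≐-trans (commutes⇒□ X Y M.isAdjointPreserving (□∈S N.isMeetRelation U∈S))
        (≐-trans (□-resp-≐ (commutes⇒□ Y Z N.isAdjointPreserving U∈S))
                 (≐-sym (□NM (Z.□-closed U∈S))))))
    ; adjoint  = adj
    }
  }
  where
  module X = RelSSpace X
  module Y = RelSSpace Y
  module Z = RelSSpace Z
  module M = AdjointPreserving M
  module N = AdjointPreserving N

  NM : Relation X.space Z.space
  NM = compose X.space Y.space Z.space N.rel M.rel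

  □NM : {U : Pred Z.Point m} → U ∈ Z.S → □ NM U ≐ □ M.rel (□ N.rel U)
  □NM = □-compose X.space Y.space Z.space

  adj : {U : Pred X.Point _} {W : Pred Z.Point _} → U ∈ X.S → W ∈ Z.S →
        (∀ x → NM x ∈ Z.D W → X.hull (X.T x) ∈ X.D U) →
        ∀ x → (∀ {W′} → W′ ∈ F Z.space Z.T W → NM x ∈ Z.D W′) → X.cl x ∈ X.D U
  adj {U} {W} U∈S W∈S h x k with □∈S N.isMeetRelation W∈S
  ... | K , K∈𝒦 , p , q =
    M.adjoint U∈S (∁∈S Y.space K∈𝒦)
      (λ x′ (_ , Mx⊆) → h x′ (hull∈C Z.space _ , proj₂ (□NM W∈S) (λ t → q (Mx⊆ t))))
      x
      (λ {V} (V∈S , V⊆□) → image∈C M.isMeetRelation x , λ {y} y∈Mx →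
        proj₂ (N.adjoint V∈S W∈S
                (λ y′ (_ , Ny⊆) → hull∈C Y.space _ ,
                   hull-least Y.space V∈S (V⊆□ (p Ny⊆)))
                y
                (λ W′∈F → image∈C N.isMeetRelation y , λ n →
                   proj₂ (k W′∈F) (hull-⊇ Z.space _ (_ , y∈Mx , n))))
          (self∈cl Y.space y))

RelSP : ∀ ℓ → Category (suc (suc ℓ)) (suc (suc ℓ)) (suc ℓ)
RelSP ℓ = record
  { Obj       = RelSSpace ℓ
  ; Hom       = AdjointPreserving
  ; _≈_       = λ M N → rel M ⇔ rel N
  ; id        = λ {X} → idAdjointPreserving X
  ; _∘_       = composeAdjointPreserving
  ; equiv     = record
    { refl  = (λ p → p) , (λ p → p)
    ; sym   = λ (p , q) → q , p
    ; trans = λ (p , p′) (q , q′) → (λ x → q (p x)) , (λ x → p′ (q′ x))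
    }
  ; ∘-resp-≈  = λ {X} {Y} {Z} (p , p′) (q , q′) →
      compose-⇔ (space X) (space Y) (space Z) (space Y)
        (λ _ → (λ h r t → h (q′ r) (p′ t)) , (λ h r t → h (q r) (p t)))
  ; assoc     = λ {X} {Y} {Z} {W} P N M →
      compose-⇔ (space X) (space Y) (space W) (space Z) (λ U∈S →
        ≐-trans (□-resp-≐ (□-compose (space Y) (space Z) (space W) U∈S))
                (≐-sym (□-compose (space X) (space Y) (space Z)
                          (□∈S (isMeetRelation P) U∈S))))
  ; identityˡ = λ {X} {Y} M →
      compose-closed (space X) (space Y) (space Y) (closed M)
        (λ U∈S → □-resp-≐ (□-cl (space Y) U∈S))
  ; identityʳ = λ {X} {Y} M →
      compose-closed (space X) (space X) (space Y) (closed M)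
        (λ U∈S → □-cl (space X) (□∈S (isMeetRelation M) U∈S))
  }
  where
  open RelSSpace using (space)
  open AdjointPreserving using (rel; isMeetRelation; closed)

{-# OPTIONS --safe #-}

-- A RelS-space enters RelSP only through the SLata of its closed sets S(X), on which d is □ T
-- and i U is ⋂ F U: a meet-relation is determined by its box on S, and compactness of the members
-- of 𝒦 turns every homomorphism S(Y) → S(X) into the box of an adjoint-preserving relation.
-- Hence, as soon as SLatas A and B are identified with the closed sets of X and Y, morphisms
-- X → Y are the same as homomorphisms B → A, compatibly with composition, and all functor and
-- naturality laws reduce to this uniqueness.  What remains is to realise every SLata as the
-- closed sets of a space, namely of its irreducible filters, where Zorn's lemma supplies the points.

module Submission where

open import Algebra.Lattice.Properties.Semilattice
  using (∧-orderTheoreticMeetSemilattice)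
open import Algebra.Structures using (IsCommutativeBand)
open import Axiom.ExcludedMiddle using (ExcludedMiddle)
open import Data.Bool.Base using (Bool; true)
open import Data.Empty using (⊥-elim)
open import Data.List.Base using (List; []; _∷_; _++_)
open import Data.List.Relation.Unary.All using (All; []; _∷_)
open import Data.List.Relation.Unary.All.Properties using (++⁺)
open import Data.List.Relation.Unary.Any using (Any; here; there)
open import Data.List.Relation.Unary.Any.Properties using (++⁺ˡ; ++⁺ʳ)
open import Data.Product.Base using (Σ-syntax; ∃-syntax; _×_; _,_; proj₁; proj₂)
open import Data.Sum.Base using (_⊎_; inj₁; inj₂)
open import Data.Unit.Polymorphic using () renaming (⊤ to Unit)
open import Level using (Level; Lift; lift; suc; _⊔_; 0ℓ)
open import Relation.Binary.Bundles using (Poset)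
open import Relation.Binary.Core using (_⇔_)
import Relation.Binary.Lattice as Lattice
import Relation.Binary.Lattice.Properties.BoundedMeetSemilattice as BoundedMeetProperties
import Relation.Binary.Lattice.Properties.MeetSemilattice as MeetProperties
open import Relation.Binary.PropositionalEquality using (_≡_; refl)
open import Relation.Binary.Structures using (IsEquivalence)
open import Relation.Nullary using (¬_; yes; no; does; contradiction)
open import Relation.Nullary.Decidable using (decidable-stable)
open import Relation.Unary using (Pred; _∈_; _∉_; _⊆_; _≐_; ∁; _∩_; _∪_; Satisfiable)
open import Defs

private
  variable
    a ℓ m n : Level

-- Order and adjunction laws in an SLata.

module Order (A : SLataObj ℓ) where
  open SLataObj A
  open Lattice.MeetSemilattice (∧-orderTheoreticMeetSemilattice semilattice) public
    using (x∧y≤x; x∧y≤y; ∧-greatest)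
    renaming (refl to ≤-refl; trans to ≤-trans; antisym to ≤-antisym; reflexive to ≤-reflexive)

  ≤-⊤ : ∀ {x} → x ≤ ⊤
  ≤-⊤ {x} = sym (identityʳ x)

  ∧-mono : ∀ {x y u v} → x ≤ u → y ≤ v → (x ∧ y) ≤ (u ∧ v)
  ∧-mono p q = ∧-greatest (≤-trans (x∧y≤x _ _) p) (≤-trans (x∧y≤y _ _) q)

  i∘d≤ : ∀ {x} → i (d x) ≤ x
  i∘d≤ = proj₂ adjoint ≤-refl

  ≤d∘i : ∀ {x} → x ≤ d (i x)
  ≤d∘i = proj₁ adjoint ≤-refl

  i-mono : ∀ {x y} → x ≤ y → i x ≤ i y
  i-mono x≤y = proj₂ adjoint (≤-trans x≤y ≤d∘i)

  d-mono : ∀ {x y} → x ≤ y → d x ≤ d y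
  d-mono x≤y = proj₁ adjoint (≤-trans i∘d≤ x≤y)

module _ {A B : SLataObj ℓ} (f : SLataHom A B) where
  private
    module A = SLataObj A
    module B = SLataObj B
  open SLataHom f

  hom-mono : ∀ {x y} → x A.≤ y → ⟦ x ⟧ B.≤ ⟦ y ⟧
  hom-mono x≤y = B.trans (cong x≤y) (∧-homo _ _)

-- SLatas represented as the closed sets of a RelS-space.

≐-reflexive : {X : Set a} {P : Pred X m} → P ≐ P
≐-reflexive = (λ p → p) , (λ p → p)

infixr 2 _⟫_
_⟫_ : {X : Set a} {P : Pred X ℓ} {Q : Pred X m} {R : Pred X n} → P ≐ Q → Q ≐ R → P ≐ R
_⟫_ = ≐-trans

-- An isomorphism from A to the SLata of closed sets of X; that β preserves i follows by adjunction.
record Representation (X : RelSSpace ℓ) (A : SLataObj ℓ) : Set (suc ℓ) where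
  open SLataObj A
  private
    module X = RelSSpace X
  field
    β          : Carrier → Pred X.Point ℓ
    β∈S        : ∀ x → β x ∈ X.S
    surjective : ∀ {V : Pred X.Point ℓ} → V ∈ X.S → ∃[ x ] V ≐ β x
    mono       : ∀ {x y} → x ≤ y → β x ⊆ β y
    reflects   : ∀ {x y} → β x ⊆ β y → x ≤ y
    β-∧        : ∀ {x y} → β x ∩ β y ⊆ β (x ∧ y)
    β-⊤        : ∀ {p} → p ∈ β ⊤
    β-d        : ∀ {x} → β (d x) ≐ □ X.T (β x)

  open Order A

  -- Boxes live one universe up, but membership in `S` comes with a small `U` whose complement is
  -- the same set.
  surjective′ : {V : Pred X.Point m} → V ∈ X.S → ∃[ x ] V ≐ β x
  surjective′ (U , U∈𝒦 , p) =
    let x , q = surjective (∁∈S X.space U∈𝒦) in x , (p ⟫ q)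

  β-cong : ∀ {x y} → x ≈ y → β x ≐ β y
  β-cong p = mono (≤-reflexive p) , mono (≤-reflexive (sym p))

  injective : ∀ {x y} → β x ≐ β y → x ≈ y
  injective (p , q) = ≤-antisym (reflects p) (reflects q)

-- The map `h` runs against `M`: it is the box of `M` read through the two identifications. It is a
-- bare function, so that identities and composites qualify without being packaged as homomorphisms.
Represents : {X Y : RelSSpace ℓ} {A B : SLataObj ℓ} →
             Representation X A → Representation Y B →
             Relation (RelSSpace.space X) (RelSSpace.space Y) →
             (SLataObj.Carrier B → SLataObj.Carrier A) → Set (suc ℓ)
Represents ρ σ M h = ∀ b → □ M (Representation.β σ b) ≐ Representation.β ρ (h b)

-- From adjoint-preserving relations to homomorphisms, and uniqueness.

module _ {X Y : RelSSpace ℓ} {A B : SLataObj ℓ}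
         (ρ : Representation X A) (σ : Representation Y B) where
  private
    module X = RelSSpace X
    module Y = RelSSpace Y
    module A where
      open SLataObj A public
      open Order A public
    module B where
      open SLataObj B public
      open Order B public
    module ρ = Representation ρ
    module σ = Representation σ

  module _ (M : AdjointPreserving X Y) where
    open AdjointPreserving M

    private
      h : B.Carrier → A.Carrier
      h b = proj₁ (ρ.surjective′ (□∈S isMeetRelation (σ.β∈S b)))

      box : Represents ρ σ rel h
      box b = proj₂ (ρ.surjective′ (□∈S isMeetRelation (σ.β∈S b)))

      h-mono : ∀ {x y} → x B.≤ y → h x A.≤ h y
      h-mono x≤y = ρ.reflects λ p → proj₁ (box _) λ r → σ.mono x≤y (proj₂ (box _) p r)

      h-d : ∀ x → h (B.d x) A.≈ A.d (h x)
      h-d x = ρ.injective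
        (≐-sym (box _) ⟫ □-resp-≐ σ.β-d ⟫
         ≐-sym (commutes⇒□ X Y isAdjointPreserving (σ.β∈S x)) ⟫
         □-resp-≐ (box x) ⟫ ≐-sym ρ.β-d)

      i≤ : ∀ x → A.i (h x) A.≤ h (B.i x)
      i≤ x = proj₂ A.adjoint (A.≤-trans (h-mono B.≤d∘i) (A.≤-reflexive (h-d (B.i x))))

      -- Preservation of `d` gives only the other inequality; this one is the third condition on
      -- adjoint-preserving relations, for the closed sets of `i (h x)` and `x`. Its hypothesis
      -- becomes `h x ≤ d (i (h x))`, and every `W` in its conclusion is some `β c` with `x ≤ d c`,
      -- hence includes `β (i x)`.
      ≤i : ∀ x → h (B.i x) A.≤ A.i (h x)
      ≤i x = ρ.reflects λ {p} p∈ →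
        proj₂ (adjoint (ρ.β∈S (A.i (h x))) (σ.β∈S x)
          (λ q (_ , Mq⊆) → hull∈C X.space _ ,
             hull-least X.space (ρ.β∈S _)
               (proj₁ ρ.β-d (ρ.mono A.≤d∘i (proj₁ (box x) Mq⊆))))
          p
          (λ {W} (W∈S , x⊆) → image∈C isMeetRelation p , λ r →
             let c , W⊆ , ⊆W = σ.surjective W∈S in
             ⊆W (σ.mono (proj₂ B.adjoint (σ.reflects λ s →
                   proj₂ σ.β-d (λ t → W⊆ (x⊆ s t))))
                 (proj₂ (box (B.i x)) p∈ r))))
          (self∈cl X.space p)

    toHom : SLataHom B A
    toHom = record
      { ⟦_⟧    = h
      ; cong   = λ p → A.≤-antisym (h-mono (B.≤-reflexive p)) (h-mono (B.≤-reflexive (B.sym p)))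
      ; ∧-homo = λ x y → A.≤-antisym
          (A.∧-greatest (h-mono (B.x∧y≤x x y)) (h-mono (B.x∧y≤y x y)))
          (ρ.reflects λ p → proj₁ (box _) λ r →
             σ.β-∧ (proj₂ (box x) (ρ.mono (A.x∧y≤x _ _) p) r
                   , proj₂ (box y) (ρ.mono (A.x∧y≤y _ _) p) r))
      ; ⊤-homo = A.≤-antisym A.≤-⊤ (ρ.reflects λ _ → proj₁ (box _) λ _ → σ.β-⊤)
      ; i-homo = λ x → A.≤-antisym (≤i x) (i≤ x)
      ; d-homo = h-d
      }

    toHom-represents : Represents ρ σ rel (SLataHom.⟦_⟧ toHom)
    toHom-represents = box

  module _ {M N : Relation X.space Y.space} {h k : B.Carrier → A.Carrier}
           (M-h : Represents ρ σ M h) (N-k : Represents ρ σ N k) where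

    represented-unique : M ⇔ N → ∀ b → h b A.≈ k b
    represented-unique M⇔N b = ρ.injective (≐-sym (M-h b) ⟫ □-resp-⇔ M⇔N ⟫ N-k b)

    -- The set `N x` is the intersection of the closed sets including it, and by equality of boxes
    -- each of these includes `M x` as well.
    representing-⊆ : (∀ x → N x ≐ Y.hull (N x)) → (∀ b → h b A.≈ k b) →
                     ∀ {x y} → M x y → N x y
    representing-⊆ closed h≈k {x} r = proj₂ (closed x) λ U (U∈S , Nx⊆U) →
      let b , U≐b = σ.surjective U∈S
          box = □-resp-≐ U≐b ⟫ N-k b ⟫ ρ.β-cong (A.sym (h≈k b)) ⟫ ≐-sym (M-h b) ⟫
                □-resp-≐ (≐-sym U≐b)
      in proj₁ box Nx⊆U r

  representing-unique : (M N : AdjointPreserving X Y) {h k : B.Carrier → A.Carrier} →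
    Represents ρ σ (AdjointPreserving.rel M) h → Represents ρ σ (AdjointPreserving.rel N) k →
    (∀ b → h b A.≈ k b) → AdjointPreserving.rel M ⇔ AdjointPreserving.rel N
  representing-unique M N M-h N-k h≈k =
      representing-⊆ M-h N-k (AdjointPreserving.closed N) h≈k
    , representing-⊆ N-k M-h (AdjointPreserving.closed M) (λ b → A.sym (h≈k b))

represents-id : {X : RelSSpace ℓ} {A : SLataObj ℓ}
                (ρ : Representation X A) →
                Represents ρ ρ (AdjointPreserving.rel (idAdjointPreserving X)) (λ a → a)
represents-id {X = X} ρ a = □-cl (RelSSpace.space X) (Representation.β∈S ρ a)

represents-∘ : {X Y Z : RelSSpace ℓ} {A B C : SLataObj ℓ}
               (ρ : Representation X A) (σ : Representation Y B) (τ : Representation Z C)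
               (M : AdjointPreserving X Y) (N : AdjointPreserving Y Z)
               {h : SLataObj.Carrier B → SLataObj.Carrier A}
               {k : SLataObj.Carrier C → SLataObj.Carrier B} →
               Represents ρ σ (AdjointPreserving.rel M) h →
               Represents σ τ (AdjointPreserving.rel N) k →
               Represents ρ τ (AdjointPreserving.rel (composeAdjointPreserving N M)) (λ c → h (k c))
represents-∘ {X = X} {Y} {Z} ρ σ τ M N M-h N-k c =
  □-compose (RelSSpace.space X) (RelSSpace.space Y) (RelSSpace.space Z) (Representation.β∈S τ c) ⟫
  □-resp-≐ (N-k c) ⟫ M-h _

module _ (em : ∀ {a} → ExcludedMiddle a) where

  -- Classical logic and resizing.

  dne : {P : Set a} → ¬ ¬ P → P
  dne = decidable-stable em

  -- Excluded middle resizes every proposition, hence every predicate, to the lowest level.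

  Holds : Lift ℓ Bool → Set ℓ
  Holds t = t ≡ lift true

  resize : (P : Set m) → Lift ℓ Bool
  resize P = lift (does (em {P = P}))

  holds : {P : Set m} → P → Holds {ℓ} (resize P)
  holds {P = P} p with em {P = P}
  ... | yes _ = refl
  ... | no ¬p = contradiction p ¬p

  holds⁻¹ : {P : Set m} → Holds {ℓ} (resize P) → P
  holds⁻¹ {P = P} q with em {P = P}
  ... | yes p = p
  ... | no _ with () ← q

  -- Predicates on `X` form a type one level above `X`; truth-value functions stay at level `ℓ`, so
  -- that closed sets and filters can be elements of level-`ℓ` carriers.
  Subset : Set ℓ → Set ℓ
  Subset {ℓ} X = X → Lift ℓ Bool

  ∣_∣ : {X : Set ℓ} → Subset X → Pred X ℓ
  ∣ U ∣ x = Holds (U x)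

  subset : {X : Set ℓ} → Pred X m → Subset X
  subset P x = resize (P x)

  ∣subset∣ : {X : Set ℓ} (P : Pred X m) → ∣ subset P ∣ ≐ P
  ∣subset∣ P = holds⁻¹ , holds

  subset-mono : {X : Set ℓ} {P : Pred X m} {Q : Pred X n} → P ⊆ Q → ∣ subset P ∣ ⊆ ∣ subset Q ∣
  subset-mono P⊆Q x = holds (P⊆Q (holds⁻¹ x))

  -- From homomorphisms to adjoint-preserving relations.

  module _ {X Y : RelSSpace ℓ} {A B : SLataObj ℓ}
           (ρ : Representation X A) (σ : Representation Y B) (h : SLataHom B A) where
    private
      module X = RelSSpace X
      module Y = RelSSpace Y
      module A where
        open SLataObj A public
        open Order A public
      module B where
        open SLataObj B public
        open Order B public
      module ρ = Representation ρ
      module σ = Representation σ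
      open SLataHom h

      -- The largest relation with `ρ.β ⟦ b ⟧ ⊆ □ M (σ.β b)` for all `b`. The converse inclusions
      -- need compactness.
      M : Relation X.space Y.space
      M x y = Lift (suc ℓ) (∀ b → x ∈ ρ.β ⟦ b ⟧ → y ∈ σ.β b)

      -- A family of subbasic sets whose union is the complement of `M x`.
      𝒪 : X.Point → Family Y.Point
      𝒪 x O = O ∈ Y.𝒦 × ∃[ b ] (x ∈ ρ.β ⟦ b ⟧ × σ.β b ⊆ ∁ O)

      -- Since `h` preserves finite meets, the meet of the witnesses of the members of the list is a
      -- common witness; the empty list yields `⊤`.
      avoid : ∀ {x Os} → All (_∈ 𝒪 x) Os →
              ∃[ b ] (x ∈ ρ.β ⟦ b ⟧ × (∀ {y} → y ∈ σ.β b → ¬ Any (y ∈_) Os))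
      avoid [] = B.⊤ , proj₂ (ρ.β-cong ⊤-homo) ρ.β-⊤ , λ _ ()
      avoid ((_ , b , x∈b , b⊆) ∷ Os∈) with avoid Os∈
      ... | c , x∈c , c⊆ = b B.∧ c , proj₂ (ρ.β-cong (∧-homo b c)) (ρ.β-∧ (x∈b , x∈c)) ,
        λ { y∈ (here p) → b⊆ (σ.mono (B.x∧y≤x b c) y∈) p
          ; y∈ (there p) → c⊆ (σ.mono (B.x∧y≤y b c) y∈) p }

      -- Compactness of the complement of β b: if M x ⊆ β b, finitely many b′ with x ∈ β (h b′)
      -- already have their meet below b.
      box : Represents ρ σ M ⟦_⟧
      box b = ⊆ρ , λ x∈ (lift r) → r b x∈
        where
        ⊆ρ : □ M (σ.β b) ⊆ ρ.β ⟦ b ⟧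
        ⊆ρ {x} Mx⊆ with σ.β∈S b
        ... | U , U∈𝒦 , b⊆ , ⊆b with Y.compact U∈𝒦 (𝒪 x) open′ cover
          where
          open′ : ∀ {O} → O ∈ 𝒪 x → Y.Open O
          open′ {O} (O∈𝒦 , _) y∈O = O ∷ [] , O∈𝒦 ∷ [] , y∈O ∷ [] , λ { (p ∷ []) → p }
          cover : U ⊆ ⋃ (𝒪 x)
          cover {y} y∈U = dne λ none → b⊆ {y} (Mx⊆ {y} (lift λ c x∈c → dne λ y∉c →
            let O , O∈𝒦 , c⊆ , ⊆c = σ.β∈S c
                O∈𝒪 : O ∈ 𝒪 x
                O∈𝒪 = O∈𝒦 , c , x∈c , c⊆
            in none (O , O∈𝒪 , dne λ y∉O → y∉c (⊆c y∉O)))) y∈U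
        ...   | Os , Os∈ , U⊆Os with avoid Os∈
        ...     | c , x∈c , c⊆ =
          ρ.mono (hom-mono h (σ.reflects λ y∈c → ⊆b λ y∈U → c⊆ y∈c (U⊆Os y∈U))) x∈c

      M-meet : IsMeetRelation X.space Y.space M
      M-meet = record
        { □-closed = λ U∈S → let b , U≐b = σ.surjective U∈S in
            S-resp-≐ X.space (≐-sym (□-resp-≐ U≐b ⟫ box b)) (ρ.β∈S ⟦ b ⟧)
        ; closed   = λ x → hull-⊇ Y.space _ , λ p → lift λ b x∈ →
            p (σ.β b) (σ.β∈S b , λ (lift r) → r b x∈)
        }

    fromHom : AdjointPreserving X Y
    fromHom = record
      { rel = M
      ; isAdjointPreserving = record
        { isMeetRelation = M-meet
        ; commutes = compose-⇔ X.space X.space Y.space Y.space λ U∈S →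
            let b , U≐b = σ.surjective U∈S in
            □-resp-≐ (□-resp-≐ U≐b ⟫ box b) ⟫ ≐-sym ρ.β-d ⟫ ρ.β-cong (A.sym (d-homo b)) ⟫
            ≐-sym (box (B.d b)) ⟫ □-resp-≐ σ.β-d ⟫ □-resp-≐ (□-resp-≐ (≐-sym U≐b))
        -- For `U = β a` and `V = β b` the hypothesis says `h b ≤ d a`, whence
        -- `h (i b) = i (h b) ≤ a`. As `b ≤ d (i b)`, the set `β (i b)` is one of the `W` in `k`,
        -- which puts `x` into `β (h (i b))`.
        ; adjoint = λ U∈S V∈S hyp x k →
            let a , U⊆ , ⊆U = ρ.surjective U∈S
                b , V⊆ , ⊆V = σ.surjective V∈S
                hb≤da = ρ.reflects λ x∈hb → proj₂ ρ.β-d λ t →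
                  U⊆ (proj₂ (hyp _ (image∈C M-meet _ , λ r → ⊆V (proj₂ (box b) x∈hb r)))
                            (hull-⊇ X.space _ t))
                hib≤a = A.≤-trans (A.≤-reflexive (i-homo b)) (proj₂ A.adjoint hb≤da)
            in cl∈C X.space x , cl⊆ X.space U∈S
                 (⊆U (ρ.mono hib≤a (proj₁ (box (B.i b)) (proj₂ (k (σ.β∈S (B.i b) ,
                    λ y∈V → proj₁ σ.β-d (σ.mono B.≤d∘i (V⊆ y∈V))))))))
        }
      }

    fromHom-represents : Represents ρ σ (AdjointPreserving.rel fromHom) ⟦_⟧
    fromHom-represents = box

  -- The SLata of closed sets of a RelS-space.

  record ClosedSet (X : SSpace ℓ) : Set ℓ where
    open SSpace X
    field
      member : Subset Point
      closed : Holds {ℓ} (resize (∣ member ∣ ∈ S))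

  module _ (X : RelSSpace ℓ) where
    open RelSSpace X
    open ClosedSet

    private
      closedSet : {V : Pred Point m} → V ∈ S → ClosedSet space
      closedSet {V = V} V∈S = record
        { member = subset V
        ; closed = holds (S-resp-≐ space (≐-sym (∣subset∣ V)) V∈S)
        }

      ⟨_⟩ : ClosedSet space → Pred Point ℓ
      ⟨ U ⟩ = ∣ member U ∣

      ⟨_⟩∈S : (U : ClosedSet space) → ⟨ U ⟩ ∈ S
      ⟨ U ⟩∈S = holds⁻¹ (closed U)

      ∩∈S : ∀ {U V : Pred Point ℓ} → U ∈ S → V ∈ S → (U ∩ V) ∈ S
      ∩∈S (K , K∈𝒦 , U⊆ , ⊆U) (L , L∈𝒦 , V⊆ , ⊆V) = (K ∪ L) , ∪-closed K∈𝒦 L∈𝒦 ,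
        (λ { (u , v) (inj₁ k) → U⊆ u k ; (u , v) (inj₂ l) → V⊆ v l }) ,
        λ n → ⊆U (λ k → n (inj₁ k)) , ⊆V (λ l → n (inj₂ l))

      all∈S : (λ _ → Unit {ℓ}) ∈ S
      all∈S = _ , ∅-closed , (λ _ ()) , λ _ → _

      _⊓_ : ClosedSet space → ClosedSet space → ClosedSet space
      U ⊓ V = closedSet (∩∈S ⟨ U ⟩∈S ⟨ V ⟩∈S)

      -- The semilattice laws are derived from inclusion. The order of an SLata is the natural order
      -- `_⊑_` instead, so the two have to be translated into each other below.
      inclusionOrder : Lattice.BoundedMeetSemilattice ℓ ℓ ℓ
      inclusionOrder = record
        { Carrier = ClosedSet space
        ; _≈_     = λ U V → ⟨ U ⟩ ≐ ⟨ V ⟩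
        ; _≤_     = λ U V → ⟨ U ⟩ ⊆ ⟨ V ⟩
        ; _∧_     = _⊓_
        ; ⊤       = closedSet all∈S
        ; isBoundedMeetSemilattice = record
          { isMeetSemilattice = record
            { isPartialOrder = record
              { isPreorder = record
                { isEquivalence = record
                  { refl = ≐-reflexive ; sym = ≐-sym ; trans = ≐-trans }
                ; reflexive = proj₁
                ; trans = λ p q x → q (p x)
                }
              ; antisym = _,_
              }
            ; infimum = λ U V → (λ p → proj₁ (holds⁻¹ p)) , (λ p → proj₂ (holds⁻¹ p)) ,
                                λ _ p q x → holds (p x , q x)
            }
          ; maximum = λ _ _ → holds {P = Unit} _
          }
        }

      ⊓-isSemilattice =
        MeetProperties.isAlgSemilattice (Lattice.BoundedMeetSemilattice.meetSemilattice inclusionOrder)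

      _⊑_ : ClosedSet space → ClosedSet space → Set ℓ
      U ⊑ V = ⟨ U ⟩ ≐ ⟨ U ⊓ V ⟩

      ⊑⇒⊆ : ∀ {U V} → U ⊑ V → ⟨ U ⟩ ⊆ ⟨ V ⟩
      ⊑⇒⊆ (p , _) x = proj₂ (holds⁻¹ (p x))

      ⊆⇒⊑ : ∀ {U V} → ⟨ U ⟩ ⊆ ⟨ V ⟩ → U ⊑ V
      ⊆⇒⊑ p = (λ x → holds (x , p x)) , λ q → proj₁ (holds⁻¹ q)

      -- Among closed sets, `diamond U` is the least `V` with `U ⊆ □ T V`, which makes it left
      -- adjoint to `box`.
      box diamond : ClosedSet space → ClosedSet space
      box U     = closedSet (□-closed ⟨ U ⟩∈S)
      diamond U = closedSet (⋂F-closed ⟨ U ⟩∈S)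

      d-mono : ∀ {U V} → ⟨ U ⟩ ⊆ ⟨ V ⟩ → ⟨ box U ⟩ ⊆ ⟨ box V ⟩
      d-mono {U} {V} p = subset-mono {P = □ T ⟨ U ⟩} {□ T ⟨ V ⟩} λ r t → p (r t)

      i-mono : ∀ {U V} → ⟨ U ⟩ ⊆ ⟨ V ⟩ → ⟨ diamond U ⟩ ⊆ ⟨ diamond V ⟩
      i-mono {U} {V} p = subset-mono {P = ⋂ (F space T ⟨ U ⟩)} {⋂ (F space T ⟨ V ⟩)}
        λ r W (W∈S , V⊆) → r W (W∈S , λ u → V⊆ (p u))

    closedSets : SLataObj ℓ
    closedSets = record
      { boundedMeetSemilattice = record
        { Carrier = ClosedSet space
        ; _≈_     = λ U V → ⟨ U ⟩ ≐ ⟨ V ⟩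
        ; _∧_     = _⊓_
        ; ⊤       = closedSet all∈S
        ; isBoundedMeetSemilattice = record
          { isCommutativeMonoid = record
            { isMonoid = record
              { isSemigroup = IsCommutativeBand.isSemigroup ⊓-isSemilattice
              ; identity    = BoundedMeetProperties.identity inclusionOrder
              }
            ; comm = IsCommutativeBand.comm ⊓-isSemilattice
            }
          ; idem = IsCommutativeBand.idem ⊓-isSemilattice
          }
        }
      ; i       = diamond
      ; d       = box
      ; i-cong  = λ {U} {V} (p , q) → i-mono {U} {V} p , i-mono {V} {U} q
      ; d-cong  = λ {U} {V} (p , q) → d-mono {U} {V} p , d-mono {V} {U} q
      ; adjoint = λ {U} {V} →
            (λ iU⊑V → ⊆⇒⊑ {U} {box V} λ {x} u → holds {P = x ∈ □ T ⟨ V ⟩} λ t →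
               ⊑⇒⊆ {diamond U} {V} iU⊑V (holds λ W (_ , U⊆) → U⊆ u t))
          , (λ U⊑dV → ⊆⇒⊑ {diamond U} {V} λ x →
               holds⁻¹ x ⟨ V ⟩ (⟨ V ⟩∈S , λ u → holds⁻¹ (⊑⇒⊆ {U} {box V} U⊑dV u)))
      }

    closedSets-representation : Representation X closedSets
    closedSets-representation = record
      { β          = ⟨_⟩
      ; β∈S        = ⟨_⟩∈S
      ; surjective = λ V∈S → closedSet V∈S , ≐-sym (∣subset∣ _)
      ; mono       = λ {U} {V} → ⊑⇒⊆ {U} {V}
      ; reflects   = λ {U} {V} → ⊆⇒⊑ {U} {V}
      ; β-∧        = holds
      ; β-⊤        = holds {P = Unit {ℓ}} _
      ; β-d        = ∣subset∣ _
      }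

  -- Filters, maximality and separation.

  module _ (zorn : ∀ {c ℓ₁ ℓ₂ ℓ₃} → ZornsLemma c ℓ₁ ℓ₂ ℓ₃) (A : SLataObj ℓ) where
    open SLataObj A
    open Order A

    record IsFilter (F : Pred Carrier m) : Set (ℓ ⊔ m) where
      field
        ↑-closed : ∀ {x y} → x ≤ y → x ∈ F → y ∈ F
        ∧-closed : ∀ {x y} → x ∈ F → y ∈ F → (x ∧ y) ∈ F
        ⊤∈       : ⊤ ∈ F

    subset-filter : {F : Pred Carrier m} → IsFilter F → IsFilter ∣ subset F ∣
    subset-filter F-filter = record
      { ↑-closed = λ x≤y p → holds (↑-closed x≤y (holds⁻¹ p))
      ; ∧-closed = λ p q → holds (∧-closed (holds⁻¹ p) (holds⁻¹ q))
      ; ⊤∈       = holds ⊤∈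
      } where open IsFilter F-filter

    -- F is proper and not the intersection of two larger filters, stated elementwise.
    record IsIrreducible (F : Pred Carrier m) : Set (ℓ ⊔ m) where
      field
        isFilter    : IsFilter F
        proper      : Satisfiable (∁ F)
        irreducible : ∀ {x y} → x ∉ F → y ∉ F →
                      ∃[ z ] ∃[ f ] (z ∉ F × f ∈ F × (x ∧ f) ≤ z × (y ∧ f) ≤ z)
      open IsFilter isFilter public

    record IrreducibleFilter : Set ℓ where
      field
        member        : Subset Carrier
        isIrreducible : IsIrreducible ∣ member ∣
      open IsIrreducible isIrreducible public

    open IrreducibleFilter using (member)

    module _ {Q : Pred Carrier m} (Q-↑ : ∀ {x y} → x ≤ y → x ∈ Q → y ∈ Q)
             {G : Pred Carrier n} (G-filter : IsFilter G) (G⊆Q : G ⊆ Q) where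
      private
        module G = IsFilter G-filter

        record Candidate : Set (ℓ ⊔ m ⊔ n) where
          field
            set    : Subset Carrier
            filter : IsFilter ∣ set ∣
            G⊆     : G ⊆ ∣ set ∣
            ⊆Q     : ∣ set ∣ ⊆ Q
          open IsFilter filter public
        open Candidate

        candidates : Poset (ℓ ⊔ m ⊔ n) ℓ ℓ
        candidates = record
          { Carrier = Candidate
          ; _≈_     = λ E F → ∣ set E ∣ ≐ ∣ set F ∣
          ; _≤_     = λ E F → ∣ set E ∣ ⊆ ∣ set F ∣
          ; isPartialOrder = record
            { isPreorder = record
              { isEquivalence = record
                { refl = ≐-reflexive ; sym = ≐-sym ; trans = ≐-trans }
              ; reflexive = proj₁
              ; trans = λ p q x → q (p x)
              }
            ; antisym = _,_
            }
          }

        module _ (C : Pred Candidate 0ℓ)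
                 (chain : ∀ {E F} → E ∈ C → F ∈ C →
                          (∣ set E ∣ ⊆ ∣ set F ∣) ⊎ (∣ set F ∣ ⊆ ∣ set E ∣)) where

          -- Joining G covers the empty chain.
          union : Pred Carrier (ℓ ⊔ m ⊔ n)
          union x = x ∈ G ⊎ Σ[ F ∈ Candidate ] (F ∈ C × x ∈ ∣ set F ∣)

          union-filter : IsFilter union
          union-filter = record
            { ↑-closed = λ { x≤y (inj₁ p)           → inj₁ (G.↑-closed x≤y p)
                           ; x≤y (inj₂ (F , F∈ , p)) → inj₂ (F , F∈ , ↑-closed F x≤y p) }
            ; ∧-closed = meets
            ; ⊤∈       = inj₁ G.⊤∈
            }
            where
            meets : ∀ {x y} → x ∈ union → y ∈ union → (x ∧ y) ∈ union
            meets (inj₁ p) (inj₁ q) = inj₁ (G.∧-closed p q)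
            meets (inj₁ p) (inj₂ (F , F∈ , q)) = inj₂ (F , F∈ , ∧-closed F (G⊆ F p) q)
            meets (inj₂ (F , F∈ , p)) (inj₁ q) = inj₂ (F , F∈ , ∧-closed F p (G⊆ F q))
            meets (inj₂ (E , E∈ , p)) (inj₂ (F , F∈ , q)) with chain E∈ F∈
            ... | inj₁ E⊆F = inj₂ (F , F∈ , ∧-closed F (E⊆F p) q)
            ... | inj₂ F⊆E = inj₂ (E , E∈ , ∧-closed E p (F⊆E q))

          upperBound : Σ[ U ∈ Candidate ] (∀ {F} → F ∈ C → ∣ set F ∣ ⊆ ∣ set U ∣)
          upperBound = U , λ F∈ p → holds (inj₂ (_ , F∈ , p))
            where
            U : Candidate
            U = record
              { set    = subset union
              ; filter = subset-filter union-filter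
              ; G⊆     = λ p → holds (inj₁ p)
              ; ⊆Q     = λ p → union⊆Q (holds⁻¹ p)
              }
              where
              union⊆Q : union ⊆ Q
              union⊆Q (inj₁ p) = G⊆Q p
              union⊆Q (inj₂ (F , _ , p)) = ⊆Q F p

      abstract
        -- Zorn's lemma among the filters between `G` and `Q`. For `x ∉ F` the filter generated by
        -- `F` and `x` must leave `Q`, and since `Q` is an up-set it already does so at some
        -- `f ∧ x`. The general `Q` serves both separation and compactness.
        maximalFilter : Σ[ F ∈ Subset Carrier ]
          (IsFilter ∣ F ∣ × G ⊆ ∣ F ∣ × ∣ F ∣ ⊆ Q ×
           (∀ {x} → x ∉ ∣ F ∣ → ∃[ f ] (f ∈ ∣ F ∣ × (f ∧ x) ∉ Q)))
        maximalFilter with zorn candidates upperBound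
        ... | F , maximal = set F , filter F , G⊆ F , ⊆Q F , λ {x} x∉F → dne λ none →
          let extension : Pred Carrier ℓ
              extension y = ∃[ f ] (f ∈ ∣ set F ∣ × (f ∧ x) ≤ y)
              extension-filter : IsFilter extension
              extension-filter = record
                { ↑-closed = λ y≤z (f , f∈ , p) → f , f∈ , ≤-trans p y≤z
                ; ∧-closed = λ (f , f∈ , p) (g , g∈ , q) → f ∧ g , ∧-closed F f∈ g∈ ,
                    ∧-greatest (≤-trans (∧-mono (x∧y≤x f g) ≤-refl) p)
                               (≤-trans (∧-mono (x∧y≤y f g) ≤-refl) q)
                ; ⊤∈ = ⊤ , ⊤∈ F , ≤-⊤
                }
              E : Candidate
              E = record
                { set    = subset extension
                ; filter = subset-filter extension-filter
                ; G⊆     = λ p → holds (_ , G⊆ F p , x∧y≤x _ _)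
                ; ⊆Q     = λ p → let f , f∈ , q = holds⁻¹ p in
                             dne λ y∉Q → none (f , f∈ , λ fx∈Q → y∉Q (Q-↑ q fx∈Q))
                }
          in x∉F (proj₁ (maximal {E} λ p → holds (_ , p , x∧y≤x _ _)) (holds (⊤ , ⊤∈ F , x∧y≤y _ _)))

    module _ {G : Pred Carrier m} (G-filter : IsFilter G) {J : Pred Carrier n} where

      abstract
        -- A filter maximal among those that include G and miss J is irreducible.
        separation : Satisfiable J →
          (∀ {x y} → x ∈ J → y ∈ J → ∃[ g ] ∃[ z ] (g ∈ G × z ∈ J × (x ∧ g) ≤ z × (y ∧ g) ≤ z)) →
          (∀ {x} → x ∈ J → x ∉ G) →
          Σ[ P ∈ IrreducibleFilter ] (G ⊆ ∣ member P ∣ × (∀ {x} → x ∈ J → x ∉ ∣ member P ∣))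
        separation (j , j∈J) directed disjoint
          -- Avoiding everything below a member of `J`, rather than just `J`, makes `Q` an up-set.
          with maximalFilter {Q = λ x → ∀ z → z ∈ J → ¬ x ≤ z}
                 (λ x≤y p z z∈J y≤z → p z z∈J (≤-trans x≤y y≤z)) G-filter
                 (λ x∈G z z∈J x≤z → disjoint z∈J (IsFilter.↑-closed G-filter x≤z x∈G))
        ... | P , P-filter , G⊆P , P⊆Q , maximal =
          record
            { member = P
            ; isIrreducible = record
              { isFilter    = P-filter
              ; proper      = j , J∉ j∈J
              ; irreducible = irr
              }
            } , G⊆P , J∉
          where
          open IsFilter P-filter
          J∉ : ∀ {x} → x ∈ J → x ∉ ∣ P ∣
          J∉ x∈J x∈P = P⊆Q x∈P _ x∈J ≤-refl

          below : ∀ {x} → x ∉ ∣ P ∣ → ∃[ f ] ∃[ z ] (f ∈ ∣ P ∣ × z ∈ J × (f ∧ x) ≤ z)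
          below x∉P with maximal x∉P
          ... | f , f∈P , ∉Q = dne λ none → ∉Q λ z z∈J p → none (f , z , f∈P , z∈J , p)

          irr : ∀ {x y} → x ∉ ∣ P ∣ → y ∉ ∣ P ∣ →
                ∃[ z ] ∃[ f ] (z ∉ ∣ P ∣ × f ∈ ∣ P ∣ × (x ∧ f) ≤ z × (y ∧ f) ≤ z)
          irr {x} {y} x∉P y∉P with below x∉P | below y∉P
          ... | e , u , e∈P , u∈J , p | f , v , f∈P , v∈J , q with directed u∈J v∈J
          ...   | g , z , g∈G , z∈J , r , s =
            -- Meeting `x` with `e` gets below `u`, meeting `y` with `f` gets below `v`, and a
            -- further meet with `g` brings both below `z`.
            z , (e ∧ f) ∧ g , J∉ z∈J , ∧-closed (∧-closed e∈P f∈P) (G⊆P g∈G) ,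
            absorb (x∧y≤x e f) p r , absorb (x∧y≤y e f) q s
            where
            absorb : ∀ {x h h′ k u z} → h ≤ h′ → (h′ ∧ x) ≤ u → (u ∧ k) ≤ z → (x ∧ (h ∧ k)) ≤ z
            absorb {x} {h} {k = k} h≤h′ p r = ≤-trans
              (∧-greatest
                (≤-trans (∧-greatest (≤-trans (x∧y≤y x _) (≤-trans (x∧y≤x h k) h≤h′)) (x∧y≤x x _)) p)
                (≤-trans (x∧y≤y x _) (x∧y≤y h k)))
              r

    abstract
      -- Separation from the principal ideal of `a`, where `a` itself bounds any two members.
      extension : {G : Pred Carrier m} → IsFilter G → ∀ {a} → a ∉ G →
                  Σ[ P ∈ IrreducibleFilter ] (G ⊆ ∣ member P ∣ × a ∉ ∣ member P ∣)
      extension G-filter {a} a∉G =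
        let P , G⊆P , ∉P = separation G-filter {J = _≤ a} (a , ≤-refl)
              (λ {x} {y} x≤a y≤a → ⊤ , a , ⊤∈ , ≤-refl {a} ,
                 ≤-trans {x ∧ ⊤} (x∧y≤x x ⊤) x≤a , ≤-trans {y ∧ ⊤} (x∧y≤x y ⊤) y≤a)
              (λ x≤a x∈G → a∉G (↑-closed x≤a x∈G))
        in P , G⊆P , ∉P (≤-refl {a})
        where open IsFilter G-filter

    -- The closed sets of the space of irreducible filters.

    β : Carrier → Pred IrreducibleFilter ℓ
    β a P = a ∈ ∣ member P ∣

    β-∁∁ : ∀ a → β a ≐ ∁ (∁ (β a))
    β-∁∁ a = (λ p n → n p) , dne

    β-mono : ∀ {a b} → a ≤ b → β a ⊆ β b
    β-mono a≤b {P} = IrreducibleFilter.↑-closed P a≤b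

    principal-filter : ∀ a → IsFilter (a ≤_)
    principal-filter a = record
      { ↑-closed = λ x≤y a≤x → ≤-trans a≤x x≤y
      ; ∧-closed = ∧-greatest
      ; ⊤∈       = ≤-⊤
      }

    -- If `a ≤ b` fails, some irreducible filter includes the principal filter of `a` and omits `b`.
    β-reflects : ∀ {a b} → β a ⊆ β b → a ≤ b
    β-reflects {a} a⊆b = dne λ a≰b →
      let P , a⊆P , b∉P = extension (principal-filter a) a≰b in b∉P (a⊆b {P} (a⊆P ≤-refl))

    𝒦 : Family IrreducibleFilter
    𝒦 U = Lift (suc ℓ) (∃[ a ] U ≐ ∁ (β a))

    open Subbase 𝒦

    ∁β∈𝒦 : ∀ a → ∁ (β a) ∈ 𝒦
    ∁β∈𝒦 a = lift (a , ≐-reflexive)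

    β∈S : ∀ a → β a ∈ S
    β∈S a = _ , ∁β∈𝒦 a , β-∁∁ a

    S⇒β : {V : Pred IrreducibleFilter m} → V ∈ S → ∃[ a ] V ≐ β a
    S⇒β (U , lift (a , p , q) , r , s) =
      a , (λ x → dne λ x∉a → r x (q x∉a)) , λ x∈a → s λ x∈U → p x∈U x∈a

    -- Compactness of the subbasic sets.

    module _ (𝒪 : Family IrreducibleFilter) where

      FinitelyCovered : Pred IrreducibleFilter m → Set (m ⊔ suc ℓ)
      FinitelyCovered Z = Σ[ Os ∈ List (Pred IrreducibleFilter ℓ) ]
        (All (_∈ 𝒪) Os × (∀ {x} → x ∈ Z → Any (x ∈_) Os))

      cover-∷ : ∀ {Us Os : List (Pred IrreducibleFilter ℓ)} {O R} →
                (All (R ∈_) Us → R ∈ O) → (¬ All (R ∈_) Us → Any (R ∈_) Os) → Any (R ∈_) (O ∷ Os)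
      cover-∷ {Us} {R = R} here′ there′ with em {P = All (R ∈_) Us}
      ... | yes p = here (here′ p)
      ... | no ¬p = there (there′ ¬p)

      module _ (a : Carrier) where

        Uncovered : Pred Carrier (suc ℓ)
        Uncovered x = ¬ FinitelyCovered (β x ∩ ∁ (β a))

        Uncovered-↑ : ∀ {x y} → x ≤ y → x ∈ Uncovered → y ∈ Uncovered
        Uncovered-↑ {x} {y} x≤y x∉ (Os , Os∈ , c) =
          x∉ (Os , Os∈ , λ {P} (p , q) → c {P} (β-mono {x} {y} x≤y {P} p , q))

        module _ (F : Subset Carrier) (F-filter : IsFilter ∣ F ∣)
                 (maximal : ∀ {x} → x ∉ ∣ F ∣ → ∃[ f ] (f ∈ ∣ F ∣ × (f ∧ x) ∉ Uncovered))
                 (P : IrreducibleFilter) (F⊆P : ∣ F ∣ ⊆ ∣ member P ∣) where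
          open IsFilter F-filter

          abstract
            -- Each `U` in the list is some `∁ (β c)` with `c ∉ P`, so `c ∉ F`, and maximality gives
            -- `g ∈ F` with `β (g ∧ c)` finitely covered outside `β a`. A point of `β (f ∧ g)`
            -- either contains `c` and is covered this way, or lies in `U` and must miss a later set
            -- of the list.
            cover-outside : ∀ {Us} → All (_∈ 𝒦) Us → All (P ∈_) Us →
              ∃[ f ] (f ∈ ∣ F ∣ × FinitelyCovered (λ R → R ∈ β f × R ∉ β a × ¬ All (R ∈_) Us))
            cover-outside [] [] = ⊤ , ⊤∈ , [] , [] , λ (_ , _ , n) → ⊥-elim (n [])
            cover-outside {U ∷ Us} (lift (c , U⊆ , ⊆U) ∷ Us∈) (P∈U ∷ P∈Us) =
              let f , f∈F , Os , Os∈ , cov = cover-outside Us∈ P∈Us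
                  g , g∈F , covered = maximal {c} (λ c∈F → U⊆ {P} P∈U (F⊆P c∈F))
                  Os′ , Os′∈ , cov′ = dne covered
              in f ∧ g , ∧-closed f∈F g∈F , Os ++ Os′ , ++⁺ Os∈ Os′∈ , both f g cov cov′
              where
              both : ∀ f g {Os Os′ : List (Pred IrreducibleFilter ℓ)} →
                (∀ {R} → R ∈ β f × R ∉ β a × ¬ All (R ∈_) Us → Any (R ∈_) Os) →
                (∀ {R} → R ∈ (β (g ∧ c) ∩ ∁ (β a)) → Any (R ∈_) Os′) →
                ∀ {R} → R ∈ β (f ∧ g) × R ∉ β a × ¬ All (R ∈_) (U ∷ Us) → Any (R ∈_) (Os ++ Os′)
              both f g {Os} cov cov′ {R} (p , q , n) with em {P = R ∈ β c}
              ... | yes c∈R = ++⁺ʳ Os (cov′ {R}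
                (IrreducibleFilter.∧-closed R (β-mono (x∧y≤y f g) {R} p) c∈R , q))
              ... | no c∉R = ++⁺ˡ (cov {R} (β-mono (x∧y≤x f g) {R} p , q , λ r → n (⊆U {R} c∉R ∷ r)))

        abstract
          -- Take a filter F maximal among those with no β f − β a, f ∈ F, finitely covered, and an
          -- irreducible P ⊇ F with a ∉ P.  A basic open set around P inside a member of 𝒪 is cut
          -- out by elements c ∉ P, to each of which the maximality of F applies.
          ∁β-compact : (∀ {O} → O ∈ 𝒪 → Open O) → ∁ (β a) ⊆ ⋃ 𝒪 → FinitelyCovered (∁ (β a))
          ∁β-compact open′ cover = dne contradictory
            where
            module _ (F : Subset Carrier) (F-filter : IsFilter ∣ F ∣) (F⊆Q : ∣ F ∣ ⊆ Uncovered)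
                     (maximal : ∀ {x} → x ∉ ∣ F ∣ → ∃[ f ] (f ∈ ∣ F ∣ × (f ∧ x) ∉ Uncovered)) where

              a∉F : a ∉ ∣ F ∣
              -- Nothing of `β a` lies outside `β a`, so the empty list would cover.
              a∉F a∈F = F⊆Q {a} a∈F ([] , [] , λ (p , n) → ⊥-elim (n p))

              covered : ∀ P → ∣ F ∣ ⊆ ∣ member P ∣ → P ∉ β a → ∃[ f ] (f ∈ ∣ F ∣ × f ∉ Uncovered)
              covered P F⊆P a∉P =
                let O , O∈𝒪 , P∈O = cover {P} a∉P
                    Us , Us∈ , P∈Us , Us⊆O = open′ {O} O∈𝒪 {P} P∈O
                    f , f∈F , Os , Os∈ , c = cover-outside F F-filter maximal P F⊆P Us∈ P∈Us
                -- The set `O` takes care of the basic neighbourhood of `P`, and `Os` of the rest of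
                -- `β f` outside `β a`.
                in f , f∈F , λ f∈Q → f∈Q (O ∷ Os , O∈𝒪 ∷ Os∈ , λ {R} (p , q) →
                     cover-∷ {Us} {Os} {O} {R} (Us⊆O {R}) (λ n → c {R} (p , q , n)))

              impossible : ¬ (Σ[ P ∈ IrreducibleFilter ] (∣ F ∣ ⊆ ∣ member P ∣ × P ∉ β a))
              impossible (P , F⊆P , a∉P) =
                let f , f∈F , f∉Q = covered P F⊆P a∉P in f∉Q (F⊆Q {f} f∈F)

            contradictory : ¬ ¬ FinitelyCovered (∁ (β a))
            contradictory uncovered =
              let F , F-filter , _ , F⊆Q , maximal =
                    maximalFilter {Q = Uncovered} (λ {x} {y} → Uncovered-↑ {x} {y})
                      {G = ⊤ ≤_} (principal-filter ⊤) base
              in impossible F F-filter F⊆Q maximal (extension F-filter {a} (a∉F F F-filter F⊆Q maximal))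
              where
              base : (⊤ ≤_) ⊆ Uncovered
              -- Every filter contains `⊤`, hence `x`, so this would be a finite cover of all of
              -- `∁ (β a)`.
              base {x} ⊤≤x (Os , Os∈ , c) = uncovered (Os , Os∈ , λ {P} q →
                c {P} (β-mono {⊤} {x} ⊤≤x {P} (IrreducibleFilter.⊤∈ P) , q))

    -- The points of a set Y ∈ C are exactly the irreducible filters above {a ∣ Y ⊆ β a}.
    S4-irreducible : ∀ {Y} {𝒥 : Family IrreducibleFilter} → Y ∈ C → 𝒥 ⊆ S → IsFamilyFor Y 𝒥 →
                     (∀ {V} → V ∈ 𝒥 → Satisfiable (Y ∩ ∁ V)) →
                     Satisfiable (Y ∩ ⋂ (complements 𝒥))
    S4-irreducible {Y} {𝒥} (𝒜 , 𝒜⊆S , Y⊆ , ⊆Y) 𝒥⊆S family meets =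
      let P , G⊆P , J∉P = separated in
      P , ⊆Y (λ V V∈𝒜 → let a , V⊆ , ⊆V = S⇒β (𝒜⊆S V∈𝒜) in
                        ⊆V {P} (G⊆P λ p → V⊆ (Y⊆ p V V∈𝒜)))
        , λ W (V , V∈𝒥 , W⊆ , ⊆W) → let a , V≐a = S⇒β (𝒥⊆S V∈𝒥) in
                        ⊆W λ P∈V → J∉P (V , V∈𝒥 , V≐a) (proj₁ V≐a P∈V)
      where
      open IsFamilyFor family
      G : Pred Carrier (suc ℓ)
      G a = Y ⊆ β a

      G-filter : IsFilter G
      G-filter = record
        { ↑-closed = λ x≤y p {P} q → β-mono x≤y {P} (p q)
        ; ∧-closed = λ p q {P} r → IrreducibleFilter.∧-closed P (p r) (q r)
        ; ⊤∈       = λ {P} _ → IrreducibleFilter.⊤∈ P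
        }

      J : Pred Carrier (suc ℓ)
      J a = Σ[ V ∈ Pred IrreducibleFilter ℓ ] (V ∈ 𝒥 × V ≐ β a)

      separated : Σ[ P ∈ IrreducibleFilter ] (G ⊆ ∣ member P ∣ × (∀ {x} → x ∈ J → x ∉ ∣ member P ∣))
      separated = separation G-filter {J = J}
        (let V , V∈𝒥 = nonempty ; a , V≐a = S⇒β (𝒥⊆S V∈𝒥) in a , V , V∈𝒥 , V≐a)
        -- The set `H ⊇ Y` belonging to the `Y`-family is some `β g`; its `g` is the element of `G`
        -- that directedness of `J` asks for.
        (λ {a} {b} (U , U∈𝒥 , _ , ⊆U) (V , V∈𝒥 , _ , ⊆V) →
          let H , E , H∈S , E∈𝒥 , Y⊆H , U⊆ , V⊆ = directed U∈𝒥 V∈𝒥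
              g , H⊆ , ⊆H = S⇒β H∈S
              e , E⊆ , ⊆E = S⇒β (𝒥⊆S E∈𝒥)
          in g , e , (λ y → H⊆ (Y⊆H y)) , (E , E∈𝒥 , E⊆ , ⊆E) ,
             β-reflects (λ {P} p → E⊆ {P} (U⊆ {P} (⊆U {P} (β-mono (x∧y≤x a g) {P} p) ,
                                         ⊆H {P} (β-mono (x∧y≤y a g) {P} p)))) ,
             β-reflects (λ {P} p → E⊆ {P} (V⊆ {P} (⊆V {P} (β-mono (x∧y≤x b g) {P} p) ,
                                         ⊆H {P} (β-mono (x∧y≤y b g) {P} p)))))
        (λ (V , V∈𝒥 , _ , ⊆V) Y⊆a → let P , y , n = meets V∈𝒥 in n (⊆V (Y⊆a y)))

    irreducibleFilters : SSpace ℓ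
    irreducibleFilters = record
      { points = record
        { Carrier = IrreducibleFilter
        ; _≈_ = λ P R → ∣ member P ∣ ≐ ∣ member R ∣
        ; isEquivalence = record { refl = ≐-reflexive ; sym = ≐-sym ; trans = ≐-trans }
        }
      ; 𝒦 = 𝒦
      ; 𝒦-resp-≐ = λ U≐V (lift (a , U≐)) → lift (a , ≐-trans (≐-sym U≐V) U≐)
      ; member-resp-≈ = λ (lift (a , U⊆ , ⊆U)) (_ , q) P∈U → ⊆U λ p → U⊆ P∈U (q p)
      ; T₀ = λ {P} {R} same →
          let same′ = λ {a} → same {∁ (β a)} λ {x} x∉a →
                ∁ (β a) ∷ [] , ∁β∈𝒦 a ∷ [] , x∉a ∷ [] , λ { (p ∷ []) → p }
          in (λ p → dne λ q → proj₂ same′ q p) , (λ p → dne λ q → proj₁ same′ q p)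
      ; covers = λ P → let a , a∉P = IrreducibleFilter.proper P in ∁ (β a) , ∁β∈𝒦 a , a∉P
      ; compact = λ (lift (a , U⊆ , ⊆U)) 𝒪 open′ cover →
          let Os , Os∈ , c = ∁β-compact 𝒪 a open′ (λ p → cover (⊆U p))
          in Os , Os∈ , λ p → c (U⊆ p)
      ; ∪-closed = λ (lift (a , U⊆ , ⊆U)) (lift (b , V⊆ , ⊆V)) → lift (a ∧ b ,
          (λ { {P} (inj₁ u) p → U⊆ u (β-mono (x∧y≤x a b) {P} p)
             ; {P} (inj₂ v) p → V⊆ v (β-mono (x∧y≤y a b) {P} p) }) ,
          λ {P} ab∉P → dne λ n → n (inj₁ (⊆U λ a∈P → n (inj₂ (⊆V λ b∈P →
            ab∉P (IrreducibleFilter.∧-closed P a∈P b∈P))))))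
      ; ∅-closed = lift (⊤ , (λ ()) , λ {P} n → ⊥-elim (n (IrreducibleFilter.⊤∈ P)))
      -- By irreducibility `a ∧ f` and `b ∧ f` lie below some `c ∉ P` with `f ∈ P`. A filter that
      -- omits `c` but contains `f` therefore omits both `a` and `b`.
      ; S3 = λ {P} (lift (a , U⊆ , ⊆U)) (lift (b , V⊆ , ⊆V)) (u , v) →
          let c , f , c∉P , f∈P , p , q = IrreducibleFilter.irreducible P (U⊆ u) (V⊆ v) in
          ∁ (β f) , ∁ (β c) , ∁β∈𝒦 f , ∁β∈𝒦 c , (λ n → n f∈P) , c∉P , λ {R} c∉R →
          dne λ n → n (inj₂ λ f∈R → n (inj₁
            ( ⊆U (λ a∈R → c∉R (β-mono p {R} (IrreducibleFilter.∧-closed R a∈R f∈R)))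
            , ⊆V (λ b∈R → c∉R (β-mono q {R} (IrreducibleFilter.∧-closed R b∈R f∈R))))))
      ; S4 = S4-irreducible
      }

    -- The A-relation on irreducible filters.

    -- The canonical accessibility relation of modal logic, with `d` as the box operator.
    d-relation : Relation irreducibleFilters irreducibleFilters
    d-relation P R = Lift (suc ℓ) (∀ a → d a ∈ ∣ member P ∣ → a ∈ ∣ member R ∣)

    -- As a right adjoint, `d` preserves finite meets, so the elements that `d` sends into `P` form
    -- a filter; when it omits `a`, an irreducible extension omitting `a` is a `d-relation`
    -- successor of `P`.
    □-d-relation : ∀ a → □ d-relation (β a) ≐ β (d a)
    □-d-relation a = (λ {P} h → dne λ da∉P →
        let module P = IrreducibleFilter P
            Q , G⊆Q , a∉Q = extension {G = λ b → d b ∈ ∣ member P ∣} (record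
              { ↑-closed = λ x≤y → P.↑-closed (d-mono x≤y)
              ; ∧-closed = λ p q → P.↑-closed
                  (proj₁ adjoint (∧-greatest (≤-trans (i-mono (x∧y≤x _ _)) i∘d≤)
                                             (≤-trans (i-mono (x∧y≤y _ _)) i∘d≤)))
                  (P.∧-closed p q)
              ; ⊤∈ = P.↑-closed (proj₁ adjoint ≤-⊤) P.⊤∈
              }) da∉P
        in a∉Q (h {Q} (lift λ _ → G⊆Q)))
      , λ p (lift r) → r a p

    filterSpace : RelSSpace ℓ
    filterSpace = record
      { space = irreducibleFilters
      ; T = d-relation
      ; isARelation = record
        { resp-≈ = (λ (p , _) (lift r) → lift λ a da∈ → p (r a da∈))
                 , (λ (_ , q) (lift r) → lift λ a da∈ → r a (q da∈))
        ; □-closed = λ U∈S → let a , U≐a = S⇒β U∈S in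
            S-resp-≐ irreducibleFilters (≐-sym (□-resp-≐ U≐a ⟫ □-d-relation a)) (β∈S (d a))
        -- A closed set `β b` belongs to the family exactly if `a ≤ d b`, that is `i a ≤ b`; so the
        -- intersection is `β (i a)`.
        ; ⋂F-closed = λ U∈S → let a , U⊆ , ⊆U = S⇒β U∈S in
            S-resp-≐ irreducibleFilters
              ( (λ {P} p V (V∈S , U⊆□) → let b , V⊆ , ⊆V = S⇒β V∈S in
                   ⊆V (β-mono (proj₂ adjoint (β-reflects λ {R} a∈R →
                         proj₁ (□-d-relation b) {R} λ {Q} t → V⊆ {Q} (U⊆□ {R} (⊆U {R} a∈R) {Q} t))) {P} p))
              , (λ p → p (β (i a)) (β∈S (i a) , λ {R} u {Q} →
                   proj₂ (□-d-relation (i a)) {R} (β-mono ≤d∘i {R} (U⊆ u)) {Q})))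
              (β∈S (i a))
        }
      }

    filterSpace-representation : Representation filterSpace A
    filterSpace-representation = record
      { β          = β
      ; β∈S        = β∈S
      ; surjective = S⇒β
      ; mono       = λ x≤y {P} → β-mono x≤y {P}
      ; reflects   = β-reflects
      ; β-∧        = λ {_} {_} {P} (p , q) → IrreducibleFilter.∧-closed P p q
      ; β-⊤        = λ {P} → IrreducibleFilter.⊤∈ P
      ; β-d        = ≐-sym (□-d-relation _)
      }

  -- The two functors and the natural isomorphisms.

  module _ (zorn : ∀ {c ℓ₁ ℓ₂ ℓ₃} → ZornsLemma c ℓ₁ ℓ₂ ℓ₃) (ℓ : Level) where
    private
      module SLata = Category (SLata ℓ)
      module RelSP = Category (RelSP ℓ)

      X : SLata.Obj → RelSP.Obj
      X = filterSpace zorn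

      S : RelSP.Obj → SLata.Obj
      S = closedSets

      ρ : ∀ A → Representation (X A) A
      ρ = filterSpace-representation zorn

      σ : ∀ Y → Representation Y (S Y)
      σ = closedSets-representation

      open AdjointPreserving using (rel)
      open SLataHom using (⟦_⟧)

      -- Two spaces with the same SLata are isomorphic through the relation of the identity
      -- homomorphism; this gives the counit.
      rel-id : {Y Z : RelSP.Obj} {A : SLata.Obj} (α : Representation Y A) (β : Representation Z A) →
               AdjointPreserving Y Z
      rel-id α β = fromHom α β SLata.id

      module _ {Y : RelSP.Obj} {A B : SLata.Obj} (α : Representation Y A) (β : Representation Y B) where

        -- Dually, two SLatas represented by one space are isomorphic through the box of the
        -- identity relation; this gives the unit.
        change : SLataHom B A
        change = toHom α β RelSP.id

        change-represents : Represents α β (rel (RelSP.id {Y})) ⟦ change ⟧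
        change-represents = toHom-represents α β RelSP.id

      change-inverse : {Y : RelSP.Obj} {A B : SLata.Obj}
                       (α : Representation Y A) (β : Representation Y B) →
                       change α β SLata.∘ change β α SLata.≈ SLata.id
      change-inverse {Y} α β = represented-unique α α
        (represents-∘ α β α (RelSP.id {Y}) (RelSP.id {Y}) (change-represents α β) (change-represents β α))
        (represents-id α)
        (RelSP.identityˡ (RelSP.id {Y}))

      rel-id-inverse : {Y Z : RelSP.Obj} {A : SLata.Obj}
                       (α : Representation Y A) (β : Representation Z A) →
                       rel-id β α RelSP.∘ rel-id α β RelSP.≈ RelSP.id
      rel-id-inverse {Y} {A = A} α β = representing-unique α α
        (rel-id β α RelSP.∘ rel-id α β) RelSP.id
        (represents-∘ α β α (rel-id α β) (rel-id β α)
          (fromHom-represents α β SLata.id) (fromHom-represents β α SLata.id))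
        (represents-id α)
        (λ _ → SLataObj.refl A)

    filterFunctor : Functor (op (SLata ℓ)) (RelSP ℓ)
    filterFunctor = record
      { F₀ = X
      ; F₁ = F₁
      ; F-resp-≈ = λ {A} {B} {f} {g} → representing-unique (ρ A) (ρ B) (F₁ f) (F₁ g)
          (fromHom-represents (ρ A) (ρ B) f) (fromHom-represents (ρ A) (ρ B) g)
      ; identity = λ {A} → representing-unique (ρ A) (ρ A) (F₁ SLata.id) RelSP.id
          (fromHom-represents (ρ A) (ρ A) SLata.id) (represents-id (ρ A)) (λ _ → SLataObj.refl A)
      ; homomorphism = λ {A} {B} {C} g f →
          representing-unique (ρ A) (ρ C) (F₁ (f SLata.∘ g)) (F₁ g RelSP.∘ F₁ f)
            (fromHom-represents (ρ A) (ρ C) (f SLata.∘ g))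
            (represents-∘ (ρ A) (ρ B) (ρ C) (F₁ f) (F₁ g)
              (fromHom-represents (ρ A) (ρ B) f) (fromHom-represents (ρ B) (ρ C) g))
            (λ _ → SLataObj.refl A)
      }
      where
      F₁ : ∀ {A B} → SLataHom B A → AdjointPreserving (X A) (X B)
      F₁ {A} {B} = fromHom (ρ A) (ρ B)

    closedSetFunctor : Functor (RelSP ℓ) (op (SLata ℓ))
    closedSetFunctor = record
      { F₀ = S
      ; F₁ = F₁
      ; F-resp-≈ = λ {Y} {Z} {M} {N} → represented-unique (σ Y) (σ Z)
          {rel M} {rel N} {⟦ F₁ M ⟧} {⟦ F₁ N ⟧} (represents M) (represents N)
      ; identity = λ {Y} → represented-unique (σ Y) (σ Y)
          {rel (RelSP.id {Y})} {h = ⟦ F₁ (RelSP.id {Y}) ⟧} {λ U → U}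
          (represents (RelSP.id {Y})) (represents-id (σ Y)) ((λ p → p) , (λ p → p))
      ; homomorphism = λ {Y} {Z} {W} N M → represented-unique (σ Y) (σ W)
          {rel (N RelSP.∘ M)} {h = ⟦ F₁ (N RelSP.∘ M) ⟧} {⟦ F₁ M SLata.∘ F₁ N ⟧}
          (represents (N RelSP.∘ M))
          (represents-∘ (σ Y) (σ Z) (σ W) M N {⟦ F₁ M ⟧} {⟦ F₁ N ⟧} (represents M) (represents N))
          ((λ p → p) , (λ p → p))
      }
      where
      F₁ : ∀ {Y Z} → AdjointPreserving Y Z → SLataHom (S Z) (S Y)
      F₁ {Y} {Z} = toHom (σ Y) (σ Z)

      represents : ∀ {Y Z} (M : AdjointPreserving Y Z) → Represents (σ Y) (σ Z) (rel M) ⟦ F₁ M ⟧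
      represents {Y} {Z} = toHom-represents (σ Y) (σ Z)

    duality : DuallyEquivalent (SLata ℓ) (RelSP ℓ)
    duality = record
      { F = filterFunctor
      ; G = closedSetFunctor
      ; unit = record
        { η       = λ A → change (ρ A) (σ (X A))
        ; η⁻¹     = λ A → change (σ (X A)) (ρ A)
        -- The two sides of the square are represented by `M` composed with an identity on either
        -- side.
        ; natural = λ {A} {B} f →
            let M = fromHom (ρ A) (ρ B) f in
            represented-unique (ρ A) (σ (X B))
              (represents-∘ (ρ A) (ρ B) (σ (X B)) M RelSP.id
                (fromHom-represents (ρ A) (ρ B) f) (change-represents (ρ B) (σ (X B))))
              (represents-∘ (ρ A) (σ (X A)) (σ (X B)) RelSP.id M
                (change-represents (ρ A) (σ (X A))) (toHom-represents (σ (X A)) (σ (X B)) M))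
              (IsEquivalence.trans RelSP.equiv {RelSP.id RelSP.∘ M} {M} {M RelSP.∘ RelSP.id}
                (RelSP.identityˡ M)
                (IsEquivalence.sym RelSP.equiv {M RelSP.∘ RelSP.id} {M} (RelSP.identityʳ M)))
        ; isoˡ    = λ A → change-inverse (ρ A) (σ (X A))
        ; isoʳ    = λ A → change-inverse (σ (X A)) (ρ A)
        }
      ; counit = record
        { η       = λ Y → rel-id (ρ (S Y)) (σ Y)
        ; η⁻¹     = λ Y → rel-id (σ Y) (ρ (S Y))
        ; natural = λ {Y} {Z} M →
            let h = toHom (σ Y) (σ Z) M
                N = fromHom (ρ (S Y)) (ρ (S Z)) h
                ε = λ Y → rel-id (ρ (S Y)) (σ Y)
                ε-represents = λ Y → fromHom-represents (ρ (S Y)) (σ Y) SLata.id in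
            -- Both composites represent `h`, because each `ε` represents the identity.
            representing-unique (ρ (S Y)) (σ Z) (ε Z RelSP.∘ N) (M RelSP.∘ ε Y)
              (represents-∘ (ρ (S Y)) (ρ (S Z)) (σ Z) N (ε Z)
                (fromHom-represents (ρ (S Y)) (ρ (S Z)) h) (ε-represents Z))
              (represents-∘ (ρ (S Y)) (σ Y) (σ Z) (ε Y) M {λ U → U} {⟦ h ⟧}
                (ε-represents Y) (toHom-represents (σ Y) (σ Z) M))
              (λ U → SLataObj.refl (S Y) {⟦ h ⟧ U})
        ; isoˡ    = λ Y → rel-id-inverse (ρ (S Y)) (σ Y)
        ; isoʳ    = λ Y → rel-id-inverse (σ Y) (ρ (S Y))
        }
      }

theorem3p2 : (em : ∀ {a} → ExcludedMiddle a)
    (zorn : ∀ {c ℓ₁ ℓ₂ ℓ₃} → ZornsLemma c ℓ₁ ℓ₂ ℓ₃) →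
    (ℓ : Level) → DuallyEquivalent (SLata ℓ) (RelSP ℓ)
theorem3p2 em zorn ℓ = duality em zorn ℓ
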